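{- Let $\mathbb{F}_q$ be a finite field and let $r\colon\mathbb{N}\to\mathbb{N}$ be a function with $r(n)=o(\log_q n)$. Then there is a function $\epsilon\colon\mathbb{N}\to[0,\infty)$ with $\epsilon(n)\to0$ as $n\to\infty$ such that for all $n\in\mathbb{N}$, all $m\in\mathbb{N}$ and all $\xi\in(0,1)$, the Grassmann complex $\mathrm{Gr}_{n,q}$ is an $(m,r(n),\xi,\xi+\epsilon(n))$ UG coboundary expander.
   Context: The Grassmann complex $\mathrm{Gr}_{n,q}$ has as its $i$-level faces, $i\le n$, the $i$-dimensional linear subspaces of $\mathbb{F}_q^n$, with the uniform measure on each level. (It is not a simplicial complex, but the same definitions are used.) For $t\le n/3$, $E_t$ is the set of ordered pairs $(u,v)$ of $t$-dimensional subspaces that are disjoint, i.e. intersect only in $0$. A triangle is a triple $(u,v,w)$ of $t$-dimensional subspaces with $\dim(u+v+w)=3t$; a random triangle is obtained by choosing a uniformly random $3t$-dimensional subspace $T$ and a uniformly random splitting $T=u\oplus v\oplus w$ into $t$-dimensional subspaces. A function $\pi\colon E_t\to S_m$ with $\pi(u,v)=\pi(v,u)^{ -1}$ is $(1-\xi)$-consistent on triangles if $\Pr[\pi(u,v)\pi(v,w)=\pi(u,w)]\ge1-\xi$ for a random triangle. The complex is an $(m,r,\xi,c)$ UG coboundary expander if for all $t\le r$ (with $t\le n/3$) and every such $\pi\colon E_t\to S_m$ that is $(1-\xi)$-consistent on triangles, there is a function $g$ from the $t$-dimensional subspaces to $S_m$ such that $\Pr[\pi(u,v)=g(u)g(v)^{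 -1}]\ge1-c$ for uniformly random $(u,v)\in E_t$. -}

module Defs where

open import Algebra.Bundles using (Ring)
open import Algebra.Properties.Ring using (-1*x≈-x)
open import Algebra.Structures using (IsCommutativeRing)
open import Data.Empty using (⊥-elim)
open import Data.Fin.Base as Fin using (Fin; funToFin)
import Data.Fin.Properties as Finₚ
open import Data.Fin.Permutation as Perm using (Permutation′; flip; _∘ₚ_; _⟨$⟩ʳ_)
open import Data.Fin.Subset using (Subset; inside; outside; _∈_)
open import Data.Fin.Subset.Properties using (_∈?_)
open import Data.Integer.Base as ℤ using (+_)
import Data.Integer.Properties as ℤₚ
import Data.Integer.Solver as ℤ-Solver
open import Data.Irrelevant using (Irrelevant; [_])
open import Data.List.Base as List using (List; []; _∷_; length; cartesianProduct)
open import Data.Nat.Base as ℕ using (ℕ; zero; suc; NonTrivial; z≤n; s≤s)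
import Data.Nat.Properties as ℕₚ
open import Data.Product using (Σ; Σ-syntax; ∃; ∃-syntax; _×_; _,_; proj₁; proj₂)
open import Data.Rational.Base as ℚ using (ℚ; 0ℚ; 1ℚ; mkℚ; *≤*; *<*)
import Data.Rational.Properties as ℚₚ
import Data.Rational.Solver as ℚ-Solver
import Data.Rational.Unnormalised.Base as ℚᵘ
import Data.Rational.Unnormalised.Properties as ℚᵘₚ
open import Data.Refinement using (Refinement; Refinement-syntax; _,_; value)
import Data.Sum as Sum
open import Data.Vec.Base as Vec using (Vec; []; _∷_; lookup; replicate)
import Data.Vec.Properties as Vecₚ
open import Function.Bundles using (_↔_; Inverse; Injection)
open import Function.Properties.Inverse using (↔⇒↣)
open import Level using (0ℓ)
open import Relation.Binary.PropositionalEquality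
open import Relation.Nullary using (Dec; yes; no; does; ¬_)
open import Relation.Nullary.Decidable
  using (map′; _×-dec_; _→-dec_; ¬?; decidable-stable; via-injection)
open import Data.Bool.Base using (if_then_else_)

-- Real numbers as Cauchy sequences of rationals.  Two sequences denote the
-- same real when each is ≤ℝ the other; only order relations are needed.

record ℝ : Set where
  field
    approx : ℕ → ℚ
    cauchy : ∀ δ → 0ℚ ℚ.< δ →
             ∃[ N ] (∀ i j → N ℕ.≤ i → N ℕ.≤ j → ℚ.∣ approx i ℚ.- approx j ∣ ℚ.≤ δ)
open ℝ public

infix 4 _≤ℝ_ _<ℝ_

_≤ℝ_ : ℝ → ℝ → Set
x ≤ℝ y = ∀ δ → 0ℚ ℚ.< δ → ∃[ N ] (∀ i → N ℕ.≤ i → approx x i ℚ.≤ approx y i ℚ.+ δ)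

_<ℝ_ : ℝ → ℝ → Set
x <ℝ y = ∃[ δ ] (0ℚ ℚ.< δ × ∃[ N ] (∀ i → N ℕ.≤ i → approx x i ℚ.+ δ ℚ.≤ approx y i))

fromℚ : ℚ → ℝ
fromℚ p .approx _ = p
fromℚ p .cauchy δ 0<δ = 0 , λ _ _ _ _ →
  subst (λ z → ℚ.∣ z ∣ ℚ.≤ δ) (sym (ℚₚ.+-inverseʳ p)) (ℚₚ.<⇒≤ 0<δ)

fromℕ : ℕ → ℝ
fromℕ n = fromℚ (+ n ℚ./ 1)

0ℝ 1ℝ : ℝ
0ℝ = fromℚ 0ℚ
1ℝ = fromℚ 1ℚ

half : ∀ {δ} → 0ℚ ℚ.< δ → ∃[ η ] (0ℚ ℚ.< η × η ℚ.+ η ≡ δ)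
half {δ} 0<δ = δ ℚ.* ℚ.½
  , subst (ℚ._< δ ℚ.* ℚ.½) (ℚₚ.*-zeroˡ ℚ.½) (ℚₚ.*-monoˡ-<-pos ℚ.½ 0<δ)
  , trans (sym (ℚₚ.*-distribˡ-+ δ ℚ.½ ℚ.½)) (ℚₚ.*-identityʳ δ)

∣p∣≤ : ∀ {p r} → p ℚ.≤ r → ℚ.- p ℚ.≤ r → ℚ.∣ p ∣ ℚ.≤ r
∣p∣≤ {p} {r} p≤r -p≤r =
  Sum.[ (λ e → subst (ℚ._≤ r) (sym e) p≤r) , (λ e → subst (ℚ._≤ r) (sym e) -p≤r) ]′
    (ℚₚ.∣p∣≡p∨∣p∣≡-p p)

flip-difference : ∀ a b → ℚ.- (a ℚ.- b) ≡ b ℚ.- a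
flip-difference = solve 2 (λ a b → :- (a :- b) := b :- a) refl
  where open ℚ-Solver.+-*-Solver

add-sub : ∀ a b → a ℚ.+ b ℚ.- a ≡ b
add-sub = solve 2 (λ a b → a :+ b :- a := b) refl
  where open ℚ-Solver.+-*-Solver

infixl 6 _+ℝ_ _-ℝ_
infixl 7 _*ℝ_
infix  8 -ℝ_

_+ℝ_ : ℝ → ℝ → ℝ
(x +ℝ y) .approx i = approx x i ℚ.+ approx y i
(x +ℝ y) .cauchy δ 0<δ with half 0<δ
... | η , 0<η , η+η≡δ with cauchy x η 0<η | cauchy y η 0<η
... | N , x-close | M , y-close = N ℕ.⊔ M , λ i j N⊔M≤i N⊔M≤j → begin
    ℚ.∣ approx x i ℚ.+ approx y i ℚ.- (approx x j ℚ.+ approx y j) ∣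
      ≡⟨ cong ℚ.∣_∣ (rearrange (approx x i) (approx y i) (approx x j) (approx y j)) ⟩
    ℚ.∣ (approx x i ℚ.- approx x j) ℚ.+ (approx y i ℚ.- approx y j) ∣
      ≤⟨ ℚₚ.∣p+q∣≤∣p∣+∣q∣ (approx x i ℚ.- approx x j) (approx y i ℚ.- approx y j) ⟩
    ℚ.∣ approx x i ℚ.- approx x j ∣ ℚ.+ ℚ.∣ approx y i ℚ.- approx y j ∣
      ≤⟨ ℚₚ.+-mono-≤
           (x-close i j (ℕₚ.m⊔n≤o⇒m≤o N M N⊔M≤i) (ℕₚ.m⊔n≤o⇒m≤o N M N⊔M≤j))
           (y-close i j (ℕₚ.m⊔n≤o⇒n≤o N M N⊔M≤i) (ℕₚ.m⊔n≤o⇒n≤o N M N⊔M≤j)) ⟩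
    η ℚ.+ η ≡⟨ η+η≡δ ⟩
    δ ∎
  where
  open ℚₚ.≤-Reasoning
  rearrange : ∀ a b c d → a ℚ.+ b ℚ.- (c ℚ.+ d) ≡ (a ℚ.- c) ℚ.+ (b ℚ.- d)
  rearrange = solve 4 (λ a b c d → a :+ b :- (c :+ d) := (a :- c) :+ (b :- d)) refl
    where open ℚ-Solver.+-*-Solver

-ℝ_ : ℝ → ℝ
(-ℝ x) .approx i = ℚ.- approx x i
(-ℝ x) .cauchy δ 0<δ with cauchy x δ 0<δ
... | N , x-close = N , λ i j N≤i N≤j →
    subst (ℚ._≤ δ) (trans (sym (ℚₚ.∣-p∣≡∣p∣ (approx x i ℚ.- approx x j)))
                          (cong ℚ.∣_∣ (ℚₚ.neg-distrib-+ (approx x i) (ℚ.- approx x j))))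
          (x-close i j N≤i N≤j)

_-ℝ_ : ℝ → ℝ → ℝ
x -ℝ y = x +ℝ (-ℝ y)

∣_∣ℝ : ℝ → ℝ
∣ x ∣ℝ .approx i = ℚ.∣ approx x i ∣
∣ x ∣ℝ .cauchy δ 0<δ with cauchy x δ 0<δ
... | N , x-close = N , λ i j N≤i N≤j →
    ℚₚ.≤-trans (reverse-triangle (approx x i) (approx x j)) (x-close i j N≤i N≤j)
  where
  open ℚₚ.≤-Reasoning

  one-sided : ∀ a b → ℚ.∣ a ∣ ℚ.- ℚ.∣ b ∣ ℚ.≤ ℚ.∣ a ℚ.- b ∣
  one-sided a b = begin
    ℚ.∣ a ∣ ℚ.- ℚ.∣ b ∣                    ≡⟨ cong (λ z → ℚ.∣ z ∣ ℚ.- ℚ.∣ b ∣) (split a b) ⟩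
    ℚ.∣ (a ℚ.- b) ℚ.+ b ∣ ℚ.- ℚ.∣ b ∣
      ≤⟨ ℚₚ.+-monoˡ-≤ (ℚ.- ℚ.∣ b ∣) (ℚₚ.∣p+q∣≤∣p∣+∣q∣ (a ℚ.- b) b) ⟩
    ℚ.∣ a ℚ.- b ∣ ℚ.+ ℚ.∣ b ∣ ℚ.- ℚ.∣ b ∣  ≡⟨ cancel ℚ.∣ a ℚ.- b ∣ ℚ.∣ b ∣ ⟩
    ℚ.∣ a ℚ.- b ∣                          ∎
    where
    open ℚ-Solver.+-*-Solver
    split : ∀ a b → a ≡ (a ℚ.- b) ℚ.+ b
    split = solve 2 (λ a b → a := (a :- b) :+ b) refl
    cancel : ∀ c d → c ℚ.+ d ℚ.- d ≡ c
    cancel = solve 2 (λ c d → c :+ d :- d := c) refl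

  reverse-triangle : ∀ a b → ℚ.∣ ℚ.∣ a ∣ ℚ.- ℚ.∣ b ∣ ∣ ℚ.≤ ℚ.∣ a ℚ.- b ∣
  reverse-triangle a b = ∣p∣≤ (one-sided a b) (begin
    ℚ.- (ℚ.∣ a ∣ ℚ.- ℚ.∣ b ∣)  ≡⟨ flip-difference ℚ.∣ a ∣ ℚ.∣ b ∣ ⟩
    ℚ.∣ b ∣ ℚ.- ℚ.∣ a ∣        ≤⟨ one-sided b a ⟩
    ℚ.∣ b ℚ.- a ∣              ≡⟨ cong ℚ.∣_∣ (flip-difference a b) ⟨
    ℚ.∣ ℚ.- (a ℚ.- b) ∣        ≡⟨ ℚₚ.∣-p∣≡∣p∣ (a ℚ.- b) ⟩
    ℚ.∣ a ℚ.- b ∣              ∎)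

0<1 : 0ℚ ℚ.< 1ℚ
0<1 = ℚₚ.positive⁻¹ 1ℚ

eventual-bound : ∀ x → ∃[ B ] (0ℚ ℚ.< B × ∃[ N ] (∀ i → N ℕ.≤ i → ℚ.∣ approx x i ∣ ℚ.≤ B))
eventual-bound x with cauchy x 1ℚ 0<1
... | N , x-close = ℚ.∣ approx x N ∣ ℚ.+ 1ℚ
    , ℚₚ.<-≤-trans 0<1 (subst (ℚ._≤ ℚ.∣ approx x N ∣ ℚ.+ 1ℚ) (ℚₚ.+-identityˡ 1ℚ)
                              (ℚₚ.+-monoˡ-≤ 1ℚ (ℚₚ.0≤∣p∣ (approx x N))))
    , N , λ i N≤i → begin
      ℚ.∣ approx x i ∣ ≡⟨ cong ℚ.∣_∣ (split (approx x i) (approx x N)) ⟩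
      ℚ.∣ approx x N ℚ.+ (approx x i ℚ.- approx x N) ∣
        ≤⟨ ℚₚ.∣p+q∣≤∣p∣+∣q∣ (approx x N) (approx x i ℚ.- approx x N) ⟩
      ℚ.∣ approx x N ∣ ℚ.+ ℚ.∣ approx x i ℚ.- approx x N ∣
        ≤⟨ ℚₚ.+-monoʳ-≤ ℚ.∣ approx x N ∣ (x-close i N N≤i ℕₚ.≤-refl) ⟩
      ℚ.∣ approx x N ∣ ℚ.+ 1ℚ ∎
  where
  open ℚₚ.≤-Reasoning
  split : ∀ a b → a ≡ b ℚ.+ (a ℚ.- b)
  split = solve 2 (λ a b → a := b :+ (a :- b)) refl
    where open ℚ-Solver.+-*-Solver

shrink : ∀ B → 0ℚ ℚ.< B → ∀ δ → 0ℚ ℚ.< δ → ∃[ η ] (0ℚ ℚ.< η × B ℚ.* η ≡ δ)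
shrink B 0<B δ 0<δ = δ ℚ.* 1/B
  , subst (ℚ._< δ ℚ.* 1/B) (ℚₚ.*-zeroˡ 1/B) (ℚₚ.*-monoˡ-<-pos 1/B 0<δ)
  , (begin
    B ℚ.* (δ ℚ.* 1/B) ≡⟨ swap B δ 1/B ⟩
    δ ℚ.* (B ℚ.* 1/B) ≡⟨ cong (δ ℚ.*_) (ℚₚ.*-inverseʳ B) ⟩
    δ ℚ.* 1ℚ          ≡⟨ ℚₚ.*-identityʳ δ ⟩
    δ                 ∎)
  where
  open ≡-Reasoning
  instance
    B-positive : ℚ.Positive B
    B-positive = ℚ.positive 0<B
    B-nonZero : ℚ.NonZero B
    B-nonZero = ℚ.>-nonZero 0<B
  1/B : ℚ
  1/B = ℚ.1/ B
  instance
    1/B-positive : ℚ.Positive 1/B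
    1/B-positive = ℚₚ.1/pos⇒pos B
  swap : ∀ a b c → a ℚ.* (b ℚ.* c) ≡ b ℚ.* (a ℚ.* c)
  swap = solve 3 (λ a b c → a :* (b :* c) := b :* (a :* c)) refl
    where open ℚ-Solver.+-*-Solver

*-mono-≤-∣∣ : ∀ {a b c d} → ℚ.∣ a ∣ ℚ.≤ c → ℚ.∣ b ∣ ℚ.≤ d → ℚ.∣ a ℚ.* b ∣ ℚ.≤ c ℚ.* d
*-mono-≤-∣∣ {a} {b} {c} {d} a≤c b≤d = begin
  ℚ.∣ a ℚ.* b ∣       ≡⟨ ℚₚ.∣p*q∣≡∣p∣*∣q∣ a b ⟩
  ℚ.∣ a ∣ ℚ.* ℚ.∣ b ∣ ≤⟨ ℚₚ.*-monoʳ-≤-nonNeg ℚ.∣ b ∣ {{ℚₚ.∣-∣-nonNeg b}} a≤c ⟩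
  c ℚ.* ℚ.∣ b ∣       ≤⟨ ℚₚ.*-monoˡ-≤-nonNeg c {{ℚ.nonNegative (ℚₚ.≤-trans (ℚₚ.0≤∣p∣ a) a≤c)}} b≤d ⟩
  c ℚ.* d             ∎
  where open ℚₚ.≤-Reasoning

telescope : ∀ a b c d → a ℚ.* b ℚ.- c ℚ.* d ≡ a ℚ.* (b ℚ.- d) ℚ.+ d ℚ.* (a ℚ.- c)
telescope = solve 4 (λ a b c d → a :* b :- c :* d := a :* (b :- d) :+ d :* (a :- c)) refl
  where open ℚ-Solver.+-*-Solver

product-close : ∀ {a b c d B C η} → ℚ.∣ a ∣ ℚ.≤ B → ℚ.∣ d ∣ ℚ.≤ C →
                ℚ.∣ a ℚ.- c ∣ ℚ.≤ η → ℚ.∣ b ℚ.- d ∣ ℚ.≤ η →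
                ℚ.∣ a ℚ.* b ℚ.- c ℚ.* d ∣ ℚ.≤ (B ℚ.+ C) ℚ.* η
product-close {a} {b} {c} {d} {B} {C} {η} a≤B d≤C a-c≤η b-d≤η = begin
  ℚ.∣ a ℚ.* b ℚ.- c ℚ.* d ∣
    ≡⟨ cong ℚ.∣_∣ (telescope a b c d) ⟩
  ℚ.∣ a ℚ.* (b ℚ.- d) ℚ.+ d ℚ.* (a ℚ.- c) ∣
    ≤⟨ ℚₚ.∣p+q∣≤∣p∣+∣q∣ (a ℚ.* (b ℚ.- d)) (d ℚ.* (a ℚ.- c)) ⟩
  ℚ.∣ a ℚ.* (b ℚ.- d) ∣ ℚ.+ ℚ.∣ d ℚ.* (a ℚ.- c) ∣
    ≤⟨ ℚₚ.+-mono-≤ (*-mono-≤-∣∣ {a} {b ℚ.- d} a≤B b-d≤η) (*-mono-≤-∣∣ {d} {a ℚ.- c} d≤C a-c≤η) ⟩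
  B ℚ.* η ℚ.+ C ℚ.* η  ≡⟨ ℚₚ.*-distribʳ-+ η B C ⟨
  (B ℚ.+ C) ℚ.* η      ∎
  where open ℚₚ.≤-Reasoning

_*ℝ_ : ℝ → ℝ → ℝ
(x *ℝ y) .approx i = approx x i ℚ.* approx y i
(x *ℝ y) .cauchy δ 0<δ =
  let B , 0<B , K , x-bound = eventual-bound x
      C , 0<C , L , y-bound = eventual-bound y
      η , 0<η , [B+C]η≡δ    = shrink (B ℚ.+ C) (ℚₚ.+-mono-< 0<B 0<C) δ 0<δ
      N , x-close           = cauchy x η 0<η
      M , y-close           = cauchy y η 0<η
  in K ℕ.⊔ L ℕ.⊔ (N ℕ.⊔ M) , λ i j p q →
    let K⊔L≤i = ℕₚ.m⊔n≤o⇒m≤o (K ℕ.⊔ L) (N ℕ.⊔ M) p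
        K⊔L≤j = ℕₚ.m⊔n≤o⇒m≤o (K ℕ.⊔ L) (N ℕ.⊔ M) q
        N⊔M≤i = ℕₚ.m⊔n≤o⇒n≤o (K ℕ.⊔ L) (N ℕ.⊔ M) p
        N⊔M≤j = ℕₚ.m⊔n≤o⇒n≤o (K ℕ.⊔ L) (N ℕ.⊔ M) q
    in subst (ℚ.∣ approx x i ℚ.* approx y i ℚ.- approx x j ℚ.* approx y j ∣ ℚ.≤_) [B+C]η≡δ
      (product-close {approx x i} {approx y i} {approx x j} {approx y j}
        (x-bound i (ℕₚ.m⊔n≤o⇒m≤o K L K⊔L≤i))
        (y-bound j (ℕₚ.m⊔n≤o⇒n≤o K L K⊔L≤j))
        (x-close i j (ℕₚ.m⊔n≤o⇒m≤o N M N⊔M≤i) (ℕₚ.m⊔n≤o⇒m≤o N M N⊔M≤j))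
        (y-close i j (ℕₚ.m⊔n≤o⇒n≤o N M N⊔M≤i) (ℕₚ.m⊔n≤o⇒n≤o N M N⊔M≤j)))

_⟶0 : (ℕ → ℝ) → Set
f ⟶0 = ∀ δ → 0ℝ <ℝ δ → ∃[ N ] (∀ n → N ℕ.≤ n → ∣ f n ∣ℝ <ℝ δ)

_=o_ : (ℕ → ℝ) → (ℕ → ℝ) → Set
f =o g = ∀ δ → 0ℝ <ℝ δ → ∃[ N ] (∀ n → N ℕ.≤ n → ∣ f n ∣ℝ ≤ℝ δ *ℝ ∣ g n ∣ℝ)

-- The largest a ≤ b with q ^ a ≤ M.
largestExponent : (q M b : ℕ) → ℕ
largestExponent q M zero    = zero
largestExponent q M (suc b) with q ℕ.^ suc b ℕₚ.≤? M
... | yes _ = suc b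
... | no  _ = largestExponent q M b

-- Searching up to M suffices, since a < q ^ a for 1 < q.
⌊log⌋ : (q M : ℕ) → ℕ
⌊log⌋ q M = largestExponent q M M

module LogarithmBounds (q : ℕ) {{_ : NonTrivial q}} where

  instance
    q-nonZero : ℕ.NonZero q
    q-nonZero = ℕ.nonTrivial⇒nonZero q

  1<q : 1 ℕ.< q
  1<q = ℕ.nonTrivial⇒n>1 q

  n<q^n : ∀ n → n ℕ.< q ℕ.^ n
  n<q^n zero    = s≤s z≤n
  n<q^n (suc n) = ℕₚ.≤-<-trans (n<q^n n) (ℕₚ.^-monoʳ-< q 1<q (ℕₚ.n<1+n n))

  lower : ∀ M b → 1 ℕ.≤ M → q ℕ.^ largestExponent q M b ℕ.≤ M
  lower M zero    1≤M = 1≤M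
  lower M (suc b) 1≤M with q ℕ.^ suc b ℕₚ.≤? M
  ... | yes p = p
  ... | no  _ = lower M b 1≤M

  upper : ∀ M b → M ℕ.< q ℕ.^ suc b → M ℕ.< q ℕ.^ suc (largestExponent q M b)
  upper M zero    p = p
  upper M (suc b) p with q ℕ.^ suc b ℕₚ.≤? M
  ... | yes _   = p
  ... | no  ≰M  = upper M b (ℕₚ.≰⇒> ≰M)

  ⌊log⌋-lower : ∀ M → 1 ℕ.≤ M → q ℕ.^ ⌊log⌋ q M ℕ.≤ M
  ⌊log⌋-lower M = lower M M

  ⌊log⌋-upper : ∀ M → M ℕ.< q ℕ.^ suc (⌊log⌋ q M)
  ⌊log⌋-upper M =
    upper M M (ℕₚ.<-trans (n<q^n M) (ℕₚ.^-monoʳ-< q 1<q (ℕₚ.n<1+n M)))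

  -- a / J < (b + 1) / K for a = ⌊log_q n^J⌋ and b = ⌊log_q n^K⌋
  cross : ∀ n {{_ : ℕ.NonZero n}} J K → .{{ℕ.NonZero J}} →
          ⌊log⌋ q (n ℕ.^ J) ℕ.* K ℕ.≤ suc (⌊log⌋ q (n ℕ.^ K)) ℕ.* J
  cross n J K = ℕₚ.≮⇒≥ λ too-big → ℕₚ.<-irrefl refl (begin-strict
    n ℕ.^ (J ℕ.* K)           ≡⟨ cong (n ℕ.^_) (ℕₚ.*-comm J K) ⟩
    n ℕ.^ (K ℕ.* J)           ≡⟨ ℕₚ.^-*-assoc n K J ⟨
    (n ℕ.^ K) ℕ.^ J           <⟨ ℕₚ.^-monoˡ-< J (⌊log⌋-upper (n ℕ.^ K)) ⟩
    (q ℕ.^ suc b) ℕ.^ J       ≡⟨ ℕₚ.^-*-assoc q (suc b) J ⟩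
    q ℕ.^ (suc b ℕ.* J)       ≤⟨ ℕₚ.^-monoʳ-≤ q (ℕₚ.<⇒≤ too-big) ⟩
    q ℕ.^ (a ℕ.* K)           ≡⟨ ℕₚ.^-*-assoc q a K ⟨
    (q ℕ.^ a) ℕ.^ K           ≤⟨ ℕₚ.^-monoˡ-≤ K (⌊log⌋-lower (n ℕ.^ J) (ℕₚ.m^n>0 n J)) ⟩
    (n ℕ.^ J) ℕ.^ K           ≡⟨ ℕₚ.^-*-assoc n J K ⟩
    n ℕ.^ (J ℕ.* K)           ∎)
    where
    open ℕₚ.≤-Reasoning
    a = ⌊log⌋ q (n ℕ.^ J)
    b = ⌊log⌋ q (n ℕ.^ K)

/-mono : ∀ a b j k → a ℕ.* suc k ℕ.≤ b ℕ.* suc j →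
         (+ a ℚ./ suc j) ℚ.≤ (+ b ℚ./ suc k)
/-mono a b j k p = ℚₚ.toℚᵘ-cancel-≤ (begin
  ℚ.toℚᵘ (+ a ℚ./ suc j) ≃⟨ ℚₚ.toℚᵘ-fromℚᵘ (ℚᵘ.mkℚᵘ (+ a) j) ⟩
  ℚᵘ.mkℚᵘ (+ a) j        ≤⟨ ℚᵘ.*≤* (subst₂ ℤ._≤_ (ℤₚ.pos-* a (suc k)) (ℤₚ.pos-* b (suc j)) (ℤ.+≤+ p)) ⟩
  ℚᵘ.mkℚᵘ (+ b) k        ≃⟨ ℚₚ.toℚᵘ-fromℚᵘ (ℚᵘ.mkℚᵘ (+ b) k) ⟨
  ℚ.toℚᵘ (+ b ℚ./ suc k) ∎)
  where open ℚᵘₚ.≤-Reasoning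

suc-/ : ∀ b k → (+ suc b ℚ./ suc k) ≡ (+ b ℚ./ suc k) ℚ.+ (+ 1 ℚ./ suc k)
suc-/ b k = ℚₚ.toℚᵘ-injective (begin
  ℚ.toℚᵘ (+ suc b ℚ./ suc k)
    ≈⟨ ℚₚ.toℚᵘ-fromℚᵘ (ℚᵘ.mkℚᵘ (+ suc b) k) ⟩
  ℚᵘ.mkℚᵘ (+ suc b) k
    ≈⟨ ℚᵘ.*≡* (same (+ b) (+ suc k)) ⟩
  ℚᵘ.mkℚᵘ (+ b) k ℚᵘ.+ ℚᵘ.mkℚᵘ (+ 1) k
    ≈⟨ ℚᵘₚ.+-cong (ℚₚ.toℚᵘ-fromℚᵘ (ℚᵘ.mkℚᵘ (+ b) k)) (ℚₚ.toℚᵘ-fromℚᵘ (ℚᵘ.mkℚᵘ (+ 1) k)) ⟨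
  ℚ.toℚᵘ (+ b ℚ./ suc k) ℚᵘ.+ ℚ.toℚᵘ (+ 1 ℚ./ suc k)
    ≈⟨ ℚₚ.toℚᵘ-homo-+ (+ b ℚ./ suc k) (+ 1 ℚ./ suc k) ⟨
  ℚ.toℚᵘ ((+ b ℚ./ suc k) ℚ.+ (+ 1 ℚ./ suc k)) ∎)
  where
  open import Relation.Binary.Reasoning.Setoid ℚᵘₚ.≃-setoid
  same : ∀ i K → (+ 1 ℤ.+ i) ℤ.* (K ℤ.* K) ≡ (i ℤ.* K ℤ.+ + 1 ℤ.* K) ℤ.* K
  same = solve 2 (λ i K → (con (+ 1) :+ i) :* (K :* K) := (i :* K :+ con (+ 1) :* K) :* K) refl
    where open ℤ-Solver.+-*-Solver

archimedean : ∀ δ → 0ℚ ℚ.< δ → ∃[ N ] (∀ k → N ℕ.≤ k → (+ 1 ℚ./ suc k) ℚ.≤ δ)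
archimedean δ@(mkℚ (+ suc p) d _) _ = suc d , λ k d<k → subst ((+ 1 ℚ./ suc k) ℚ.≤_) (ℚₚ.↥p/↧p≡p δ)
  (/-mono 1 (suc p) k d (ℕₚ.*-mono-≤ (s≤s (z≤n {p})) (ℕₚ.m≤n⇒m≤1+n d<k)))
archimedean (mkℚ (+ zero) d _)      (*<* (ℤ.+<+ ()))
archimedean (mkℚ ℤ.-[1+ p ] d _)    (*<* ())

∣x-y∣≤ : ∀ {x y δ} → x ℚ.≤ y ℚ.+ δ → y ℚ.≤ x ℚ.+ δ → ℚ.∣ x ℚ.- y ∣ ℚ.≤ δ
∣x-y∣≤ {x} {y} {δ} x≤y+δ y≤x+δ = ∣p∣≤
  (subst (x ℚ.- y ℚ.≤_) (add-sub y δ) (ℚₚ.+-monoˡ-≤ (ℚ.- y) x≤y+δ))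
  (subst₂ ℚ._≤_ (sym (flip-difference x y)) (add-sub x δ) (ℚₚ.+-monoˡ-≤ (ℚ.- x) y≤x+δ))

-- The limit of ⌊log_q (n ^ k)⌋ / k, where k = 1, 2, …; each term lies within
-- 1 / k of log_q n.  The value at n = 0 is a junk 0.
log : (q : ℕ) {{_ : NonTrivial q}} → ℕ → ℝ
log q zero = 0ℝ
log q n@(suc _) .approx k = + ⌊log⌋ q (n ℕ.^ suc k) ℚ./ suc k
log q n@(suc _) .cauchy δ 0<δ with archimedean δ 0<δ
... | N , 1/k≤δ = N , λ i j N≤i N≤j → ∣x-y∣≤ (close i j N≤j) (close j i N≤i)
  where
  open LogarithmBounds q
  open ℚₚ.≤-Reasoning
  a : ℕ → ℕ
  a k = ⌊log⌋ q (n ℕ.^ suc k)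
  close : ∀ i j → N ℕ.≤ j → (+ a i ℚ./ suc i) ℚ.≤ (+ a j ℚ./ suc j) ℚ.+ δ
  close i j N≤j = begin
    + a i ℚ./ suc i                        ≤⟨ /-mono (a i) (suc (a j)) i j (cross n (suc i) (suc j)) ⟩
    + suc (a j) ℚ./ suc j                  ≡⟨ suc-/ (a j) j ⟩
    (+ a j ℚ./ suc j) ℚ.+ (+ 1 ℚ./ suc j)  ≤⟨ ℚₚ.+-monoʳ-≤ (+ a j ℚ./ suc j) (1/k≤δ j N≤j) ⟩
    (+ a j ℚ./ suc j) ℚ.+ δ                ∎

record FiniteField : Set₁ where
  infixl 6 _+_
  infixl 7 _*_
  infix  8 -_
  field
    Carrier           : Set
    _+_ _*_           : Carrier → Carrier → Carrier
    -_                : Carrier → Carrier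
    0# 1#             : Carrier
    isCommutativeRing : IsCommutativeRing _≡_ _+_ _*_ -_ 0# 1#
    0≢1               : 0# ≢ 1#
    inverse           : ∀ x → x ≢ 0# → ∃[ y ] x * y ≡ 1#
    order             : ℕ
    finite            : Carrier ↔ Fin order

  open IsCommutativeRing isCommutativeRing public hiding (refl; sym; trans)

  order-nonTrivial : NonTrivial order
  order-nonTrivial = at-least-two order finite
    where
    at-least-two : ∀ k → Carrier ↔ Fin k → NonTrivial k
    at-least-two 0 f with () ← Inverse.to f 0#
    at-least-two 1 f = ⊥-elim (0≢1 (Injection.injective (↔⇒↣ f) (Fin1-trivial _ _)))
      where
      Fin1-trivial : ∀ (i j : Fin 1) → i ≡ j
      Fin1-trivial Fin.zero Fin.zero = refl
    at-least-two (suc (suc _)) _ = _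

  log-order : ℕ → ℝ
  log-order = log order {{order-nonTrivial}}

vectors : ∀ {A : Set} → List A → ∀ n → List (Vec A n)
vectors xs zero    = [] ∷ []
vectors xs (suc n) = List.cartesianProductWith _∷_ xs (vectors xs n)

subsets : ∀ n → List (Subset n)
subsets = vectors (inside ∷ outside ∷ [])

select : ∀ {A : Set} {P : A → Set} → (∀ x → Dec (P x)) → List A → List [ x ∈ A ∣ P x ]
select P? []       = []
select P? (x ∷ xs) with P? x
... | yes p = (x , [ p ]) ∷ select P? xs
... | no  _ = select P? xs

-- Expectation of f under the uniform measure on the entries of a list (which
-- is repetition-free wherever this is used).  Junk value 0 for the empty list.
𝔼 : ∀ {A : Set} → List A → (A → ℚ) → ℚ
𝔼 []          f = 0ℚ
𝔼 xs@(_ ∷ ys) f = List.foldr ℚ._+_ 0ℚ (List.map f xs) ℚ.* (+ 1 ℚ./ suc (length ys))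

Pr : ∀ {A : Set} {P : A → Set} → List A → (∀ x → Dec (P x)) → ℚ
Pr xs P? = 𝔼 xs (λ x → if does (P? x) then 1ℚ else 0ℚ)

Exhaustible : Set → Set₁
Exhaustible A = ∀ {P : A → Set} → (∀ x → Dec (P x)) → Dec (∃ P)

for-all : ∀ {A} → Exhaustible A → {P : A → Set} → (∀ x → Dec (P x)) → Dec (∀ x → P x)
for-all any P? = map′ (λ ∄¬P x → decidable-stable (P? x) (λ ¬Px → ∄¬P (x , ¬Px)))
                      (λ ∀P (x , ¬Px) → ¬Px (∀P x))
                      (¬? (any (λ x → ¬? (P? x))))

any-Vec : ∀ {A} → Exhaustible A → ∀ n → Exhaustible (Vec A n)
any-Vec any zero    P? = map′ (λ p → [] , p) (λ { ([] , p) → p }) (P? [])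
any-Vec any (suc n) P? = map′ (λ (x , xs , p) → x ∷ xs , p) (λ { (x ∷ xs , p) → x , xs , p })
                              (any (λ x → any-Vec any n (λ xs → P? (x ∷ xs))))

infixl 7 _·_
infix  8 _⁻¹

-- Products in S_m are composed right to left: (σ · τ) i = σ (τ i).
_·_ : ∀ {m} → Permutation′ m → Permutation′ m → Permutation′ m
σ · τ = τ ∘ₚ σ

_⁻¹ : ∀ {m} → Permutation′ m → Permutation′ m
σ ⁻¹ = flip σ

_≈?_ : ∀ {m} (σ τ : Permutation′ m) → Dec (σ Perm.≈ τ)
σ ≈? τ = Finₚ.all? (λ i → σ ⟨$⟩ʳ i Finₚ.≟ τ ⟨$⟩ʳ i)

module Grassmann (𝔽 : FiniteField) (n : ℕ) where
  private
    module 𝔽 = FiniteField 𝔽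
    open FiniteField 𝔽 using (Carrier; 0#; 1#; order)

  V : Set
  V = Vec Carrier n

  infixl 6 _⊕_
  infixl 7 _⊛_

  _⊕_ : V → V → V
  _⊕_ = Vec.zipWith 𝔽._+_

  _⊛_ : Carrier → V → V
  c ⊛ x = Vec.map (c 𝔽.*_) x

  𝟎 : V
  𝟎 = replicate n 0#

  combination : ∀ {d} → Vec Carrier d → Vec V d → V
  combination []       []       = 𝟎
  combination (c ∷ cs) (b ∷ bs) = c ⊛ b ⊕ combination cs bs

  -- Subsets of 𝔽 ^ n are represented by subsets of Fin (order ^ n) through the
  -- bijection 𝔽 ^ n ↔ Fin (order ^ n), so that _≡_ is extensional equality.
  VSubset : Set
  VSubset = Subset (order ℕ.^ n)

  index : V → Fin (order ℕ.^ n)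
  index x = funToFin (λ i → Inverse.to 𝔽.finite (lookup x i))

  infix 4 _∈ᵥ_

  _∈ᵥ_ : V → VSubset → Set
  x ∈ᵥ U = index x ∈ U

  IsSubspace : VSubset → Set
  IsSubspace U = 𝟎 ∈ᵥ U
               × (∀ x y → x ∈ᵥ U → y ∈ᵥ U → x ⊕ y ∈ᵥ U)
               × (∀ c x → x ∈ᵥ U → c ⊛ x ∈ᵥ U)

  IsBasis : ∀ {d} → Vec V d → VSubset → Set
  IsBasis {d} b U = (∀ i → lookup b i ∈ᵥ U)
                  × (∀ x → x ∈ᵥ U → Σ[ c ∈ Vec Carrier d ] combination c b ≡ x)
                  × (∀ c → combination c b ≡ 𝟎 → c ≡ replicate d 0#)

  HasDimension : VSubset → ℕ → Set
  HasDimension U d = Σ[ b ∈ Vec V d ] IsBasis b U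

  IsFace : ℕ → VSubset → Set
  IsFace t U = IsSubspace U × HasDimension U t

  -- The proof component is irrelevant, so faces with the same elements are equal.
  Face : ℕ → Set
  Face t = [ U ∈ VSubset ∣ IsFace t U ]

  infix 4 _∈ꟳ_

  _∈ꟳ_ : ∀ {t} → V → Face t → Set
  x ∈ꟳ u = x ∈ᵥ value u

  Disjoint : ∀ {t} → Face t × Face t → Set
  Disjoint (u , v) = ∀ x → x ∈ꟳ u → x ∈ꟳ v → x ≡ 𝟎

  Edge : ℕ → Set
  Edge t = [ uv ∈ Face t × Face t ∣ Disjoint uv ]

  -- T is the internal direct sum of u, v and w.
  IsSplitting : ∀ {s t} → Face s → Face t × Face t × Face t → Set
  IsSplitting T (u , v , w) =
      (∀ a b c → a ∈ꟳ u → b ∈ꟳ v → c ∈ꟳ w → a ⊕ b ⊕ c ∈ꟳ T)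
    × (∀ x → x ∈ꟳ T → Σ[ a ∈ V ] Σ[ b ∈ V ] Σ[ c ∈ V ]
                        (a ∈ꟳ u × b ∈ꟳ v × c ∈ꟳ w × a ⊕ b ⊕ c ≡ x))
    × (∀ a b c → a ∈ꟳ u → b ∈ꟳ v → c ∈ꟳ w → a ⊕ b ⊕ c ≡ 𝟎 → a ≡ 𝟎 × b ≡ 𝟎 × c ≡ 𝟎)

  Splitting : ∀ {s} → ℕ → Face s → Set
  Splitting t T = [ uvw ∈ Face t × Face t × Face t ∣ IsSplitting T uvw ]

  any-Carrier : Exhaustible Carrier
  any-Carrier {P} P? =
    map′ (λ (i , p) → Inverse.from 𝔽.finite i , p)
         (λ (x , p) → Inverse.to 𝔽.finite x , subst P (sym (Inverse.strictlyInverseʳ 𝔽.finite x)) p)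
         (Finₚ.any? (λ i → P? (Inverse.from 𝔽.finite i)))

  any-V : Exhaustible V
  any-V = any-Vec any-Carrier n

  _≟ᶜ_ : (x y : Carrier) → Dec (x ≡ y)
  _≟ᶜ_ = via-injection (↔⇒↣ 𝔽.finite) Finₚ._≟_

  _≟ᵥ_ : ∀ {d} (x y : Vec Carrier d) → Dec (x ≡ y)
  _≟ᵥ_ = Vecₚ.≡-dec _≟ᶜ_

  _∈ᵥ?_ : ∀ x U → Dec (x ∈ᵥ U)
  x ∈ᵥ? U = index x ∈? U

  isFace? : ∀ t U → Dec (IsFace t U)
  isFace? t U =
    ((𝟎 ∈ᵥ? U)
      ×-dec for-all any-V (λ x → for-all any-V λ y →
              (x ∈ᵥ? U) →-dec ((y ∈ᵥ? U) →-dec ((x ⊕ y) ∈ᵥ? U)))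
      ×-dec for-all any-Carrier (λ c → for-all any-V λ x → (x ∈ᵥ? U) →-dec ((c ⊛ x) ∈ᵥ? U)))
    ×-dec any-Vec any-V t (λ b →
      Finₚ.all? (λ i → lookup b i ∈ᵥ? U)
      ×-dec for-all any-V (λ x → (x ∈ᵥ? U) →-dec
              any-Vec any-Carrier t (λ c → combination c b ≟ᵥ x))
      ×-dec for-all (any-Vec any-Carrier t) (λ c →
              (combination c b ≟ᵥ 𝟎) →-dec (c ≟ᵥ replicate t 0#)))

  disjoint? : ∀ {t} (uv : Face t × Face t) → Dec (Disjoint uv)
  disjoint? (u , v) = for-all any-V λ x →
    (x ∈ᵥ? value u) →-dec ((x ∈ᵥ? value v) →-dec (x ≟ᵥ 𝟎))

  isSplitting? : ∀ {s t} (T : Face s) (uvw : Face t × Face t × Face t) → Dec (IsSplitting T uvw)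
  isSplitting? T (u , v , w) =
    for-all any-V (λ a → for-all any-V λ b → for-all any-V λ c →
      (a ∈ᵥ? value u) →-dec ((b ∈ᵥ? value v) →-dec ((c ∈ᵥ? value w) →-dec
        ((a ⊕ b ⊕ c) ∈ᵥ? value T))))
    ×-dec for-all any-V (λ x → (x ∈ᵥ? value T) →-dec
      any-V (λ a → any-V λ b → any-V λ c →
        (a ∈ᵥ? value u) ×-dec (b ∈ᵥ? value v) ×-dec (c ∈ᵥ? value w) ×-dec
          ((a ⊕ b ⊕ c) ≟ᵥ x)))
    ×-dec for-all any-V (λ a → for-all any-V λ b → for-all any-V λ c →
      (a ∈ᵥ? value u) →-dec ((b ∈ᵥ? value v) →-dec ((c ∈ᵥ? value w) →-dec
        (((a ⊕ b ⊕ c) ≟ᵥ 𝟎) →-dec ((a ≟ᵥ 𝟎) ×-dec (b ≟ᵥ 𝟎) ×-dec (c ≟ᵥ 𝟎))))))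

  faces : ∀ t → List (Face t)
  faces t = select (isFace? t) (subsets (order ℕ.^ n))

  edges : ∀ t → List (Edge t)
  edges t = select disjoint? (cartesianProduct (faces t) (faces t))

  splittings : ∀ {s} t (T : Face s) → List (Splitting t T)
  splittings t T =
    select (isSplitting? T) (cartesianProduct (faces t) (cartesianProduct (faces t) (faces t)))

  ⊕-𝟎ʳ : ∀ x → x ⊕ 𝟎 ≡ x
  ⊕-𝟎ʳ = Vecₚ.zipWith-identityʳ 𝔽.+-identityʳ

  ⊕-𝟎ˡ : ∀ x → 𝟎 ⊕ x ≡ x
  ⊕-𝟎ˡ = Vecₚ.zipWith-identityˡ 𝔽.+-identityˡ

  ⊝_ : V → V
  ⊝ x = (𝔽.- 1#) ⊛ x

  𝔽-ring : Ring 0ℓ 0ℓ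
  𝔽-ring = record { isRing = 𝔽.isRing }

  ⊕-⊝ : ∀ x → x ⊕ ⊝ x ≡ 𝟎
  ⊕-⊝ x = trans (cong (x ⊕_) (Vecₚ.map-cong (-1*x≈-x 𝔽-ring) x))
                (Vecₚ.zipWith-inverseʳ 𝔽.-‿inverseʳ x)

  IsFace-𝟎 : ∀ {t U} → IsFace t U → 𝟎 ∈ᵥ U
  IsFace-𝟎 ((𝟎∈U , _) , _) = 𝟎∈U

  IsFace-⊝ : ∀ {t U} → IsFace t U → ∀ x → x ∈ᵥ U → ⊝ x ∈ᵥ U
  IsFace-⊝ ((_ , _ , ⊛-closed) , _) = ⊛-closed (𝔽.- 1#)

  swap : ∀ {t} → Edge t → Edge t
  swap ((u , v) , [ d ]) = (v , u) , [ (λ x x∈v x∈u → d x x∈u x∈v) ]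

  module _ {s t : ℕ} (T : Face s) where

    module _ {u v w : Face t} (split : IsSplitting T (u , v , w)) where

      direct : ∀ a b c → a ∈ꟳ u → b ∈ꟳ v → c ∈ꟳ w → a ⊕ b ⊕ c ≡ 𝟎 → a ≡ 𝟎 × b ≡ 𝟎 × c ≡ 𝟎
      direct = proj₂ (proj₂ split)

      disjoint₁₂ : IsFace t (value v) → IsFace t (value w) → Disjoint (u , v)
      disjoint₁₂ fv fw x x∈u x∈v = proj₁
        (direct x (⊝ x) 𝟎 x∈u (IsFace-⊝ fv x x∈v) (IsFace-𝟎 fw)
          (trans (⊕-𝟎ʳ (x ⊕ ⊝ x)) (⊕-⊝ x)))

      disjoint₂₃ : IsFace t (value u) → IsFace t (value w) → Disjoint (v , w)
      disjoint₂₃ fu fw x x∈v x∈w = proj₁ (proj₂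
        (direct 𝟎 x (⊝ x) (IsFace-𝟎 fu) x∈v (IsFace-⊝ fw x x∈w)
          (trans (cong (_⊕ ⊝ x) (⊕-𝟎ˡ x)) (⊕-⊝ x))))

      disjoint₁₃ : IsFace t (value v) → IsFace t (value w) → Disjoint (u , w)
      disjoint₁₃ fv fw x x∈u x∈w = proj₁
        (direct x 𝟎 (⊝ x) x∈u (IsFace-𝟎 fv) (IsFace-⊝ fw x x∈w)
          (trans (cong (_⊕ ⊝ x) (⊕-𝟎ʳ x)) (⊕-⊝ x)))

    edge₁₂ edge₂₃ edge₁₃ : Splitting t T → Edge t
    edge₁₂ ((u , v@(_ , [ fv ]) , w@(_ , [ fw ])) , [ split ]) =
      (u , v) , [ disjoint₁₂ {u} {v} {w} split fv fw ]
    edge₂₃ ((u@(_ , [ fu ]) , v , w@(_ , [ fw ])) , [ split ]) =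
      (v , w) , [ disjoint₂₃ {u} {v} {w} split fu fw ]
    edge₁₃ ((u , v@(_ , [ fv ]) , w@(_ , [ fw ])) , [ split ]) =
      (u , w) , [ disjoint₁₃ {u} {v} {w} split fv fw ]

  module _ {t m : ℕ} where

    Antisymmetric : (Edge t → Permutation′ m) → Set
    Antisymmetric π = ∀ e → π e Perm.≈ π (swap e) ⁻¹

    -- Uniform 3t-dimensional T, then a uniform splitting of T.
    Pr-triangle : (Edge t → Permutation′ m) → ℚ
    Pr-triangle π = 𝔼 (faces (3 ℕ.* t)) λ T →
      Pr (splittings t T) λ uvw → (π (edge₁₂ T uvw) · π (edge₂₃ T uvw)) ≈? π (edge₁₃ T uvw)

    ConsistentOnTriangles : ℝ → (Edge t → Permutation′ m) → Set
    ConsistentOnTriangles p π = p ≤ℝ fromℚ (Pr-triangle π)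

    Pr-edge : (Edge t → Permutation′ m) → (Face t → Permutation′ m) → ℚ
    Pr-edge π g = Pr (edges t) λ e@((u , v) , _) → π e ≈? (g u · g v ⁻¹)

  UGCoboundaryExpander : (m r : ℕ) (ξ c : ℝ) → Set
  UGCoboundaryExpander m r ξ c =
    ∀ t → t ℕ.≤ r → 3 ℕ.* t ℕ.≤ n →
    (π : Edge t → Permutation′ m) → Antisymmetric π →
    ConsistentOnTriangles (1ℝ -ℝ ξ) π →
    Σ[ g ∈ (Face t → Permutation′ m) ] 1ℝ -ℝ c ≤ℝ fromℚ (Pr-edge π g)

module Submission where

-- Fix a t-space x and colour u by π(u,x).  This colouring satisfies the edge
-- (u,v) whenever the triangle (u,x,v) is consistent, so some x satisfies at
-- least as many edges as the average over x, which is the probability of a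
-- consistent triangle up to the proportion of triples (u,x,v) that are not
-- direct.  Since x contains a given nonzero vector with probability at most
-- q^(t-n), a union bound over the q^(2t) vectors of u ⊕ v makes that proportion
-- at most q^(3t-n) ≤ 1 / (1 + (n - 3 r(n))), which tends to 0.

open import Defs
open import Algebra.Properties.CommutativeSemigroup using () renaming (interchange to interchangeOf)
open import Data.Bool.Base using (if_then_else_)
import Data.Bool.Properties as Boolₚ
open import Data.Empty using (⊥-elim)
open import Data.Fin.Base as Fin using (Fin; funToFin; finToFun; combine)
open import Data.Fin.Permutation as Perm using (Permutation′; _⟨$⟩ʳ_)
import Data.Fin.Properties as Finₚ
open import Data.Fin.Subset using (inside; outside; _∈_)
open import Data.Fin.Subset.Properties using (⊆-antisym)
import Data.Integer.Base as ℤ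
open import Data.Irrelevant using ([_])
open import Data.List.Base as List using (List; []; _∷_; _++_; length; cartesianProduct; cartesianProductWith)
import Data.List.Membership.Propositional as List∈
open import Data.List.Membership.Propositional.Properties
  using (∈-tabulate⁺; ∈-cartesianProduct⁺; ∈-cartesianProductWith⁺)
open import Data.List.Properties using (length-++; length-map; length-tabulate)
open import Data.List.Relation.Unary.All using (All; []; _∷_)
open import Data.List.Relation.Unary.AllPairs using ([]; _∷_)
open import Data.List.Relation.Unary.Any using (here; there)
open import Data.List.Relation.Unary.Unique.Propositional using (Unique)
import Data.List.Relation.Unary.Unique.Propositional.Properties as Uniqueₚ
open import Data.Nat.Base as ℕ using (ℕ; zero; suc; _≤_; z≤n; s≤s; _∸_)
import Data.Nat.Properties as ℕₚ
open import Data.Nat.Solver using (module +-*-Solver)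
open import Data.Product using (Σ-syntax; ∃-syntax; _×_; _,_; proj₁; proj₂)
open import Data.Rational.Base as ℚ using (ℚ; 0ℚ; 1ℚ)
import Data.Rational.Properties as ℚₚ
import Data.Rational.Solver as ℚ-Solver
open import Data.Refinement using (_,_; value)
open import Data.Sum as Sum using (inj₁; inj₂)
open import Data.Unit.Base using (tt)
open import Data.Vec.Base as Vec using (Vec; []; _∷_; lookup; replicate)
import Data.Vec.Properties as Vecₚ
open import Function.Base using (_∘_)
open import Function.Bundles using (Inverse; Injection)
open import Function.Properties.Inverse using (↔⇒↣; ↔-sym)
open import Relation.Binary.PropositionalEquality
open import Relation.Nullary using (Dec; yes; no; does; ¬_; contradiction)
open import Relation.Nullary.Decidable using (_×-dec_; _→-dec_; ¬?; map′; recompute; dec-true)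

-- `Pr-triangle` samples in two stages, whereas the averaging runs over all triples. Two facts
-- reconcile them: all `3t`-spaces have equally many splittings, so a random triangle is uniform
-- among the pairs of a space and a splitting of it; and a direct triple determines its sum, so
-- these pairs are just the direct triples. No number of subspaces is ever evaluated: counts are
-- compared through linear maps that act injectively on subspaces, and the inequalities stay in ℕ,
-- with denominators cleared, until they are turned into probabilities.
--
-- Subspaces are not constructed to show that the lists are nonempty. Instead `ξ < 1` makes the
-- probability of a consistent triangle positive, and a positive expectation, whose junk value on an
-- empty list is 0, yields a space together with a splitting.
--
-- The bound `q ^ (3t - n)` is weakened by `k < q ^ k` to a reciprocal of a natural number. It grows
-- with `t`, so its value at `t = r(n)` serves every smaller `t`; it tends to 0 because `n - 3 r(n)`
-- tends to infinity.

-- Finite sums over lists and double counting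

module Counting where
  open import Algebra.Properties.CommutativeSemigroup ℕₚ.+-commutativeSemigroup using (interchange)
  open import Data.Nat.Base
  open import Data.Nat.Properties

  private
    variable
      A B : Set
      P Q : A → Set

  ⟦_⟧ : ∀ {P : Set} → Dec P → ℕ
  ⟦ P? ⟧ = if does P? then 1 else 0

  ⟦⟧-true : ∀ {P : Set} (P? : Dec P) → P → ⟦ P? ⟧ ≡ 1
  ⟦⟧-true (yes _) _ = refl
  ⟦⟧-true (no ¬p) p = ⊥-elim (¬p p)

  ⟦⟧-false : ∀ {P : Set} (P? : Dec P) → ¬ P → ⟦ P? ⟧ ≡ 0
  ⟦⟧-false (yes p) ¬p = ⊥-elim (¬p p)
  ⟦⟧-false (no _)  _  = refl

  ⟦⟧-≤ : ∀ {P : Set} (P? : Dec P) {k} → (P → 1 ≤ k) → ⟦ P? ⟧ ≤ k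
  ⟦⟧-≤ (yes p) h = h p
  ⟦⟧-≤ (no _)  _ = z≤n

  ⟦⟧≤1 : ∀ {P : Set} (P? : Dec P) → ⟦ P? ⟧ ≤ 1
  ⟦⟧≤1 P? = ⟦⟧-≤ P? (λ _ → ≤-refl)

  ⟦⟧-* : ∀ {P : Set} (P? : Dec P) {a b} → (P → a ≤ b) → ⟦ P? ⟧ * a ≤ b
  ⟦⟧-* (yes p) {a} h = ≤-trans (≤-reflexive (*-identityˡ a)) (h p)
  ⟦⟧-* (no _)      _ = z≤n

  ∑ : List A → (A → ℕ) → ℕ
  ∑ []       f = 0
  ∑ (x ∷ xs) f = f x + ∑ xs f

  ∑-cong : ∀ (xs : List A) {f g : A → ℕ} → (∀ x → f x ≡ g x) → ∑ xs f ≡ ∑ xs g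
  ∑-cong []       f≡g = refl
  ∑-cong (x ∷ xs) f≡g = cong₂ _+_ (f≡g x) (∑-cong xs f≡g)

  ∑-mono : ∀ (xs : List A) {f g : A → ℕ} → (∀ x → f x ≤ g x) → ∑ xs f ≤ ∑ xs g
  ∑-mono []       f≤g = z≤n
  ∑-mono (x ∷ xs) f≤g = +-mono-≤ (f≤g x) (∑-mono xs f≤g)

  ∑-zero : ∀ (xs : List A) → ∑ xs (λ _ → 0) ≡ 0
  ∑-zero []       = refl
  ∑-zero (x ∷ xs) = ∑-zero xs

  ∑-const : ∀ (xs : List A) c → ∑ xs (λ _ → c) ≡ length xs * c
  ∑-const []       c = refl
  ∑-const (x ∷ xs) c = cong (c +_) (∑-const xs c)

  ∑-+ : ∀ (xs : List A) (f g : A → ℕ) → ∑ xs (λ x → f x + g x) ≡ ∑ xs f + ∑ xs g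
  ∑-+ []       f g = refl
  ∑-+ (x ∷ xs) f g = trans (cong (f x + g x +_) (∑-+ xs f g)) (interchange (f x) (g x) (∑ xs f) (∑ xs g))

  ∑-*ˡ : ∀ (xs : List A) c (f : A → ℕ) → ∑ xs (λ x → c * f x) ≡ c * ∑ xs f
  ∑-*ˡ []       c f = sym (*-zeroʳ c)
  ∑-*ˡ (x ∷ xs) c f = trans (cong (c * f x +_) (∑-*ˡ xs c f)) (sym (*-distribˡ-+ c (f x) (∑ xs f)))

  ∑-*ʳ : ∀ (xs : List A) c (f : A → ℕ) → ∑ xs (λ x → f x * c) ≡ ∑ xs f * c
  ∑-*ʳ xs c f = trans (∑-cong xs (λ x → *-comm (f x) c)) (trans (∑-*ˡ xs c f) (*-comm c _))

  ∑-swap : ∀ (xs : List A) (ys : List B) (f : A → B → ℕ) →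
           ∑ xs (λ x → ∑ ys (f x)) ≡ ∑ ys (λ y → ∑ xs (λ x → f x y))
  ∑-swap []       ys f = sym (∑-zero ys)
  ∑-swap (x ∷ xs) ys f = trans (cong (∑ ys (f x) +_) (∑-swap xs ys f))
                               (sym (∑-+ ys (f x) (λ y → ∑ xs (λ x → f x y))))

  ∑-++ : ∀ (xs ys : List A) (f : A → ℕ) → ∑ (xs ++ ys) f ≡ ∑ xs f + ∑ ys f
  ∑-++ []       ys f = refl
  ∑-++ (x ∷ xs) ys f = trans (cong (f x +_) (∑-++ xs ys f)) (sym (+-assoc (f x) (∑ xs f) (∑ ys f)))

  ∑-map : ∀ (h : A → B) (xs : List A) (f : B → ℕ) → ∑ (List.map h xs) f ≡ ∑ xs (λ x → f (h x))
  ∑-map h []       f = refl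
  ∑-map h (x ∷ xs) f = cong (f (h x) +_) (∑-map h xs f)

  ∑-cartesianProduct : ∀ (xs : List A) (ys : List B) (f : A × B → ℕ) →
                       ∑ (cartesianProduct xs ys) f ≡ ∑ xs (λ x → ∑ ys (λ y → f (x , y)))
  ∑-cartesianProduct []       ys f = refl
  ∑-cartesianProduct (x ∷ xs) ys f =
    trans (∑-++ (List.map (x ,_) ys) (cartesianProduct xs ys) f)
          (cong₂ _+_ (∑-map (x ,_) ys f) (∑-cartesianProduct xs ys f))

  ∑-select : (P? : ∀ x → Dec (P x)) (xs : List A) (f : A → ℕ) →
             ∑ (select P? xs) (λ x → f (value x)) ≡ ∑ xs (λ x → ⟦ P? x ⟧ * f x)
  ∑-select P? []       f = refl
  ∑-select P? (x ∷ xs) f with P? x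
  ... | yes _ = cong₂ _+_ (sym (*-identityˡ (f x))) (∑-select P? xs f)
  ... | no  _ = ∑-select P? xs f

  length-select : (P? : ∀ x → Dec (P x)) (xs : List A) → length (select P? xs) ≡ ∑ xs (λ x → ⟦ P? x ⟧)
  length-select P? []       = refl
  length-select P? (x ∷ xs) with P? x
  ... | yes _ = cong suc (length-select P? xs)
  ... | no  _ = length-select P? xs

  ≤-∑ : ∀ {xs : List A} (f : A → ℕ) {x} → x List∈.∈ xs → f x ≤ ∑ xs f
  ≤-∑ f (here refl) = m≤m+n _ _
  ≤-∑ f (there x∈)  = ≤-trans (≤-∑ f x∈) (m≤n+m _ _)

  ∑≤1 : {xs : List A} → Unique xs → (P? : ∀ x → Dec (P x)) → (∀ {x y} → P x → P y → x ≡ y) →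
        ∑ xs (λ x → ⟦ P? x ⟧) ≤ 1
  ∑≤1 [] P? at-most-one = z≤n
  ∑≤1 {A = A} {P = P} {xs = x ∷ xs} (x∉ ∷ uniq) P? at-most-one with P? x
  ... | no  _ = ∑≤1 uniq P? at-most-one
  ... | yes p = ≤-reflexive (cong suc (none xs x∉))
    where
    none : ∀ ys → All (x ≢_) ys → ∑ ys (λ y → ⟦ P? y ⟧) ≡ 0
    none []       []         = refl
    none (y ∷ ys) (x≢y ∷ x∉) =
      cong₂ _+_ (⟦⟧-false (P? y) (λ q → x≢y (at-most-one p q))) (none ys x∉)

  -- Double counting of the pairs (x , y) with Q y and R x y.
  ∑-injective : {xs : List A} (ys : List B) → Unique xs →
    (P? : ∀ x → Dec (P x)) (Q? : ∀ y → Dec (Q y)) {R : A → B → Set} (R? : ∀ x y → Dec (R x y)) →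
    (∀ x → P x → ∃[ y ] (y List∈.∈ ys × Q y × R x y)) →
    (∀ {x x′} y → P x → R x y → P x′ → R x′ y → x ≡ x′) →
    ∑ xs (λ x → ⟦ P? x ⟧) ≤ ∑ ys (λ y → ⟦ Q? y ⟧)
  ∑-injective {P = P} {xs = xs} ys uniq P? Q? {R} R? image injective = begin
    ∑ xs (λ x → ⟦ P? x ⟧)
      ≤⟨ ∑-mono xs (λ x → ⟦⟧-≤ (P? x) (λ p → let y , y∈ , q , r = image x p in
           ≤-trans (≤-reflexive (sym (cong₂ _*_ (⟦⟧-true (Q? y) q) (⟦⟧-true (P? x ×-dec R? x y) (p , r)))))
                   (≤-∑ (λ y → ⟦ Q? y ⟧ * ⟦ P? x ×-dec R? x y ⟧) y∈))) ⟩
    ∑ xs (λ x → ∑ ys (λ y → ⟦ Q? y ⟧ * ⟦ P? x ×-dec R? x y ⟧))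
      ≡⟨ ∑-swap xs ys _ ⟩
    ∑ ys (λ y → ∑ xs (λ x → ⟦ Q? y ⟧ * ⟦ P? x ×-dec R? x y ⟧))
      ≡⟨ ∑-cong ys (λ y → ∑-*ˡ xs ⟦ Q? y ⟧ _) ⟩
    ∑ ys (λ y → ⟦ Q? y ⟧ * ∑ xs (λ x → ⟦ P? x ×-dec R? x y ⟧))
      ≤⟨ ∑-mono ys (λ y → *-monoʳ-≤ ⟦ Q? y ⟧ (∑≤1 uniq (λ x → P? x ×-dec R? x y)
           (λ (p , r) (p′ , r′) → injective y p r p′ r′))) ⟩
    ∑ ys (λ y → ⟦ Q? y ⟧ * 1)
      ≡⟨ ∑-cong ys (λ y → *-identityʳ ⟦ Q? y ⟧) ⟩
    ∑ ys (λ y → ⟦ Q? y ⟧) ∎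
    where open ≤-Reasoning

  -- The maximum is at least the average, with the division cleared. The extra element of `A` is the
  -- witness for the empty list.
  ∑-≤-length*max : A → (xs : List A) (f : A → ℕ) → ∃[ y ] (∑ xs f ≤ length xs * f y)
  ∑-≤-length*max x []       f = x , z≤n
  ∑-≤-length*max x (z ∷ zs) f with ∑-≤-length*max x zs f
  ... | y , h with ≤-total (f z) (f y)
  ... | inj₁ fz≤fy = y , +-mono-≤ fz≤fy h
  ... | inj₂ fy≤fz = z , +-monoʳ-≤ (f z) (≤-trans h (*-monoʳ-≤ (length zs) fy≤fz))

  -- The entry that `select` stores carries the proof found by `P?`, not `p`; irrelevance of the
  -- second component identifies the two.
  select-complete : (P? : ∀ x → Dec (P x)) {xs : List A} → ∀ {x} (p : P x) → x List∈.∈ xs →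
                    (x , [ p ]) List∈.∈ select P? xs
  select-complete P? {x ∷ xs} p (here refl) with P? x
  ... | yes _ = here refl
  ... | no ¬p = ⊥-elim (¬p p)
  select-complete P? {x ∷ xs} p (there x∈) with P? x
  ... | yes _ = there (select-complete P? p x∈)
  ... | no  _ = select-complete P? p x∈

  select-unique : (P? : ∀ x → Dec (P x)) {xs : List A} → Unique xs → Unique (select P? xs)
  select-unique P? []          = []
  select-unique P? {x ∷ xs} (x∉ ∷ uniq) with P? x
  ... | no  _ = select-unique P? uniq
  ... | yes p = fresh xs x∉ ∷ select-unique P? uniq
    where
    fresh : ∀ ys → All (x ≢_) ys → All ((x , [ p ]) ≢_) (select P? ys)
    fresh []       []         = []
    fresh (y ∷ ys) (x≢y ∷ x∉) with P? y
    ... | yes _ = (λ e → x≢y (cong value e)) ∷ fresh ys x∉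
    ... | no  _ = fresh ys x∉

  vectors-complete : {xs : List A} → (∀ x → x List∈.∈ xs) → ∀ {n} (v : Vec A n) → v List∈.∈ vectors xs n
  vectors-complete all []      = here refl
  vectors-complete all (x ∷ v) = ∈-cartesianProductWith⁺ _∷_ (all x) (vectors-complete all v)

  vectors-unique : {xs : List A} → Unique xs → ∀ n → Unique (vectors xs n)
  vectors-unique uniq zero    = [] ∷ []
  vectors-unique uniq (suc n) =
    Uniqueₚ.cartesianProductWith⁺ _∷_ (λ { refl → refl , refl }) uniq (vectors-unique uniq n)

  length-cartesianProductWith : ∀ {C : Set} (f : A → B → C) xs ys →
                                length (cartesianProductWith f xs ys) ≡ length xs * length ys
  length-cartesianProductWith f []       ys = refl
  length-cartesianProductWith f (x ∷ xs) ys =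
    trans (length-++ (List.map (f x) ys))
          (cong₂ _+_ (length-map (f x) ys) (length-cartesianProductWith f xs ys))

  length-vectors : (xs : List A) → ∀ n → length (vectors xs n) ≡ length xs ^ n
  length-vectors xs zero    = refl
  length-vectors xs (suc n) = trans (length-cartesianProductWith _∷_ xs (vectors xs n))
                                    (cong (length xs *_) (length-vectors xs n))

open Counting

-- Linear algebra over a finite field

module VectorSpace (𝔽 : FiniteField) where
  module 𝔽 = FiniteField 𝔽
  open FiniteField 𝔽 using (Carrier; 0#; 1#)

  -- With the dimension implicit, the same operations serve vectors of the ambient space and
  -- coefficient vectors of any length.
  module Operations {n : ℕ} = Grassmann 𝔽 n
  open Operations public using (_⊕_; _⊛_; 𝟎; ⊝_; combination; ⊕-𝟎ʳ; ⊕-𝟎ˡ; ⊕-⊝)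

  private
    variable
      d k n : ℕ

  ⊕-assoc : (x y z : Vec Carrier n) → x ⊕ y ⊕ z ≡ x ⊕ (y ⊕ z)
  ⊕-assoc = Vecₚ.zipWith-assoc 𝔽.+-assoc

  ⊕-comm : (x y : Vec Carrier n) → x ⊕ y ≡ y ⊕ x
  ⊕-comm = Vecₚ.zipWith-comm 𝔽.+-comm

  +-interchange : ∀ a b c d → (a 𝔽.+ b) 𝔽.+ (c 𝔽.+ d) ≡ (a 𝔽.+ c) 𝔽.+ (b 𝔽.+ d)
  +-interchange = interchangeOf (record
    { isCommutativeSemigroup = record { isSemigroup = 𝔽.+-isSemigroup ; comm = 𝔽.+-comm } })

  ⊕-interchange : (x y z w : Vec Carrier n) → (x ⊕ y) ⊕ (z ⊕ w) ≡ (x ⊕ z) ⊕ (y ⊕ w)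
  ⊕-interchange []      []      []      []      = refl
  ⊕-interchange (a ∷ x) (b ∷ y) (c ∷ z) (d ∷ w) = cong₂ _∷_ (+-interchange a b c d) (⊕-interchange x y z w)

  ⊛-distribˡ-⊕ : ∀ c (x y : Vec Carrier n) → c ⊛ (x ⊕ y) ≡ c ⊛ x ⊕ c ⊛ y
  ⊛-distribˡ-⊕ c []      []      = refl
  ⊛-distribˡ-⊕ c (a ∷ x) (b ∷ y) = cong₂ _∷_ (𝔽.distribˡ c a b) (⊛-distribˡ-⊕ c x y)

  ⊛-distribʳ-+ : ∀ c d (x : Vec Carrier n) → (c 𝔽.+ d) ⊛ x ≡ c ⊛ x ⊕ d ⊛ x
  ⊛-distribʳ-+ c d []      = refl
  ⊛-distribʳ-+ c d (a ∷ x) = cong₂ _∷_ (𝔽.distribʳ a c d) (⊛-distribʳ-+ c d x)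

  ⊛-assoc : ∀ c d (x : Vec Carrier n) → (c 𝔽.* d) ⊛ x ≡ c ⊛ (d ⊛ x)
  ⊛-assoc c d []      = refl
  ⊛-assoc c d (a ∷ x) = cong₂ _∷_ (𝔽.*-assoc c d a) (⊛-assoc c d x)

  ⊛-zeroˡ : (x : Vec Carrier n) → 0# ⊛ x ≡ 𝟎
  ⊛-zeroˡ []      = refl
  ⊛-zeroˡ (a ∷ x) = cong₂ _∷_ (𝔽.zeroˡ a) (⊛-zeroˡ x)

  ⊛-zeroʳ : ∀ c → c ⊛ 𝟎 {n} ≡ 𝟎
  ⊛-zeroʳ {zero}  c = refl
  ⊛-zeroʳ {suc n} c = cong₂ _∷_ (𝔽.zeroʳ c) (⊛-zeroʳ c)

  ⊛-identityˡ : (x : Vec Carrier n) → 1# ⊛ x ≡ x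
  ⊛-identityˡ []      = refl
  ⊛-identityˡ (a ∷ x) = cong₂ _∷_ (𝔽.*-identityˡ a) (⊛-identityˡ x)

  ⊝⊕ : (x : Vec Carrier n) → ⊝ x ⊕ x ≡ 𝟎
  ⊝⊕ x = trans (⊕-comm (⊝ x) x) (⊕-⊝ x)

  x⊕⊝y≡𝟎⇒x≡y : (x y : Vec Carrier n) → x ⊕ ⊝ y ≡ 𝟎 → x ≡ y
  x⊕⊝y≡𝟎⇒x≡y x y e = begin
    x                ≡⟨ ⊕-𝟎ʳ x ⟨
    x ⊕ 𝟎            ≡⟨ cong (x ⊕_) (⊝⊕ y) ⟨
    x ⊕ (⊝ y ⊕ y)    ≡⟨ ⊕-assoc x (⊝ y) y ⟨
    x ⊕ ⊝ y ⊕ y      ≡⟨ cong (_⊕ y) e ⟩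
    𝟎 ⊕ y            ≡⟨ ⊕-𝟎ˡ y ⟩
    y                ∎
    where open ≡-Reasoning

  x⊕[y⊕⊝x]≡y : (x y : Vec Carrier n) → x ⊕ (y ⊕ ⊝ x) ≡ y
  x⊕[y⊕⊝x]≡y x y = begin
    x ⊕ (y ⊕ ⊝ x)  ≡⟨ cong (x ⊕_) (⊕-comm y (⊝ x)) ⟩
    x ⊕ (⊝ x ⊕ y)  ≡⟨ ⊕-assoc x (⊝ x) y ⟨
    x ⊕ ⊝ x ⊕ y    ≡⟨ cong (_⊕ y) (⊕-⊝ x) ⟩
    𝟎 ⊕ y          ≡⟨ ⊕-𝟎ˡ y ⟩
    y              ∎
    where open ≡-Reasoning

  -- Covers both kinds of map by which subspaces are moved: the coordinate map of a basis and the
  -- linear automorphisms of the ambient space.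
  record LinearInjection (k l : ℕ) : Set where
    infixl 5 _$_
    field
      _$_     : Vec Carrier k → Vec Carrier l
      +-homo  : ∀ x y → _$_ (x ⊕ y) ≡ _$_ x ⊕ _$_ y
      *-homo  : ∀ c x → _$_ (c ⊛ x) ≡ c ⊛ _$_ x
      kernel  : ∀ x → _$_ x ≡ 𝟎 → x ≡ 𝟎

    𝟎-homo : _$_ 𝟎 ≡ 𝟎
    𝟎-homo = trans (cong _$_ (sym (⊛-zeroˡ 𝟎))) (trans (*-homo 0# 𝟎) (⊛-zeroˡ (_$_ 𝟎)))

    injective : ∀ {x y} → _$_ x ≡ _$_ y → x ≡ y
    injective {x} {y} e = x⊕⊝y≡𝟎⇒x≡y x y (kernel (x ⊕ ⊝ y)
      (trans (+-homo x (⊝ y)) (trans (cong₂ _⊕_ e (*-homo _ y)) (⊕-⊝ (_$_ y)))))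

    combination-homo : ∀ {d} (c : Vec Carrier d) b → _$_ (combination c b) ≡ combination c (Vec.map _$_ b)
    combination-homo []       []       = 𝟎-homo
    combination-homo (c ∷ cs) (b ∷ bs) =
      trans (+-homo (c ⊛ b) (combination cs bs)) (cong₂ _⊕_ (*-homo c b) (combination-homo cs bs))

  open LinearInjection public

  identity : LinearInjection n n
  identity = record
    { _$_ = λ x → x ; +-homo = λ _ _ → refl ; *-homo = λ _ _ → refl ; kernel = λ _ e → e }

  combination-⊕ : (c c′ : Vec Carrier d) (b : Vec (Vec Carrier n) d) →
                  combination (c ⊕ c′) b ≡ combination c b ⊕ combination c′ b
  combination-⊕ []      []        []       = sym (⊕-𝟎ˡ 𝟎)
  combination-⊕ (c ∷ cs) (c′ ∷ cs′) (b ∷ bs) =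
    trans (cong₂ _⊕_ (⊛-distribʳ-+ c c′ b) (combination-⊕ cs cs′ bs))
          (⊕-interchange (c ⊛ b) (c′ ⊛ b) (combination cs bs) (combination cs′ bs))

  combination-⊛ : ∀ c (cs : Vec Carrier d) (b : Vec (Vec Carrier n) d) →
                  combination (c ⊛ cs) b ≡ c ⊛ combination cs b
  combination-⊛ c []         []       = sym (⊛-zeroʳ c)
  combination-⊛ c (c′ ∷ cs) (b ∷ bs) =
    trans (cong₂ _⊕_ (⊛-assoc c c′ b) (combination-⊛ c cs bs))
          (sym (⊛-distribˡ-⊕ c (c′ ⊛ b) (combination cs bs)))

  combination-++ : ∀ (c : Vec Carrier d) (c′ : Vec Carrier k) (b : Vec (Vec Carrier n) d) b′ →
                   combination (c Vec.++ c′) (b Vec.++ b′) ≡ combination c b ⊕ combination c′ b′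
  combination-++ []       c′ []       b′ = sym (⊕-𝟎ˡ _)
  combination-++ (c ∷ cs) c′ (b ∷ bs) b′ =
    trans (cong (c ⊛ b ⊕_) (combination-++ cs c′ bs b′)) (sym (⊕-assoc (c ⊛ b) _ _))

  𝟎-++ : ∀ d → 𝟎 {d} Vec.++ 𝟎 {k} ≡ 𝟎
  𝟎-++ zero    = refl
  𝟎-++ (suc d) = cong (0# ∷_) (𝟎-++ d)

  *-cancel : ∀ {a b y} → b 𝔽.* y ≡ 1# → a 𝔽.* b ≡ 0# → a ≡ 0#
  *-cancel {a} {b} {y} by≡1 ab≡0 = begin
    a                ≡⟨ 𝔽.*-identityʳ a ⟨
    a 𝔽.* 1#         ≡⟨ cong (a 𝔽.*_) by≡1 ⟨
    a 𝔽.* (b 𝔽.* y)  ≡⟨ 𝔽.*-assoc a b y ⟨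
    a 𝔽.* b 𝔽.* y    ≡⟨ cong (𝔽._* y) ab≡0 ⟩
    0# 𝔽.* y         ≡⟨ 𝔽.zeroˡ y ⟩
    0#               ∎
    where open ≡-Reasoning

  record Functional (n : ℕ) : Set where
    field
      _$_    : Vec Carrier n → Carrier
      +-homo : ∀ x y → _$_ (x ⊕ y) ≡ _$_ x 𝔽.+ _$_ y
      *-homo : ∀ c x → _$_ (c ⊛ x) ≡ c 𝔽.* _$_ x

  open Functional public using () renaming (_$_ to _$ᶠ_)

  coordinate : Fin n → Functional n
  coordinate i = record
    { _$_    = λ x → lookup x i
    ; +-homo = λ x y → Vecₚ.lookup-zipWith 𝔽._+_ i x y
    ; *-homo = λ c x → Vecₚ.lookup-map i (c 𝔽.*_) x
    }

  _⊞_ : Functional n → Functional n → Functional n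
  f ⊞ g = record
    { _$_    = λ x → (f $ᶠ x) 𝔽.+ (g $ᶠ x)
    ; +-homo = λ x y → trans (cong₂ 𝔽._+_ (Functional.+-homo f x y) (Functional.+-homo g x y))
                             (+-interchange _ _ _ _)
    ; *-homo = λ c x → trans (cong₂ 𝔽._+_ (Functional.*-homo f c x) (Functional.*-homo g c x))
                             (sym (𝔽.distribˡ c _ _))
    }

  nonzero-coordinate : (x : Vec Carrier n) → x ≢ 𝟎 → ∃[ i ] lookup x i ≢ 0#
  nonzero-coordinate {n} x x≢𝟎 = Finₚ.¬∀⟶∃¬ n (λ i → lookup x i ≡ 0#)
    (λ i → Grassmann._≟ᶜ_ 𝔽 n (lookup x i) 0#)
    (λ all → x≢𝟎 (trans (sym (Vecₚ.tabulate∘lookup x))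
                 (trans (Vecₚ.tabulate-cong (λ i → trans (all i) (sym (Vecₚ.lookup-replicate i 0#))))
                        (Vecₚ.tabulate∘lookup 𝟎))))

  -- If no single one of the two chosen coordinates is nonzero at both vectors, then each vanishes
  -- at the vector for which the other was chosen, and their sum is nonzero at both.
  nonvanishing : (w w′ : Vec Carrier n) → w ≢ 𝟎 → w′ ≢ 𝟎 →
                 Σ[ f ∈ Functional n ] ((f $ᶠ w) ≢ 0# × (f $ᶠ w′) ≢ 0#)
  nonvanishing {n} w w′ w≢𝟎 w′≢𝟎 with nonzero-coordinate w w≢𝟎 | nonzero-coordinate w′ w′≢𝟎
  ... | i , wᵢ≢0 | j , w′ⱼ≢0 with Grassmann._≟ᶜ_ 𝔽 n (lookup w′ i) 0# | Grassmann._≟ᶜ_ 𝔽 n (lookup w j) 0#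
  ... | no w′ᵢ≢0 | _        = coordinate i , wᵢ≢0 , w′ᵢ≢0
  ... | yes _    | no wⱼ≢0  = coordinate j , wⱼ≢0 , w′ⱼ≢0
  ... | yes w′ᵢ≡0 | yes wⱼ≡0 = coordinate i ⊞ coordinate j
      , (λ e → wᵢ≢0 (trans (sym (trans (cong (lookup w i 𝔽.+_) wⱼ≡0) (𝔽.+-identityʳ _))) e))
      , (λ e → w′ⱼ≢0 (trans (sym (trans (cong (𝔽._+ lookup w′ j) w′ᵢ≡0) (𝔽.+-identityˡ _))) e))

  abstract
    -- x ↦ x + f x / f w (w′ - w) for a functional f vanishing neither at w nor
    -- at w′; it multiplies f by f w′ / f w, whence its kernel is trivial.
    transvection : (w w′ : Vec Carrier n) → w ≢ 𝟎 → w′ ≢ 𝟎 → Σ[ A ∈ LinearInjection n n ] (A $ w) ≡ w′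
    transvection {n} w w′ w≢𝟎 w′≢𝟎 with nonvanishing w w′ w≢𝟎 w′≢𝟎
    ... | f , fw≢0 , fw′≢0 with 𝔽.inverse _ fw≢0 | 𝔽.inverse _ fw′≢0
    ... | y , fw*y≡1 | y′ , fw′*y′≡1 = record
      { _$_ = A ; +-homo = A-+ ; *-homo = A-* ; kernel = A-kernel } , Aw≡w′
      where
      open ≡-Reasoning
      open Functional f using () renaming (_$_ to g; +-homo to g-+; *-homo to g-*)

      z : Vec Carrier n
      z = w′ ⊕ ⊝ w

      A : Vec Carrier n → Vec Carrier n
      A x = x ⊕ (g x 𝔽.* y) ⊛ z

      A-+ : ∀ x x′ → A (x ⊕ x′) ≡ A x ⊕ A x′
      A-+ x x′ = begin
        x ⊕ x′ ⊕ (g (x ⊕ x′) 𝔽.* y) ⊛ z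
          ≡⟨ cong (λ c → x ⊕ x′ ⊕ c ⊛ z) (trans (cong (𝔽._* y) (g-+ x x′)) (𝔽.distribʳ y _ _)) ⟩
        x ⊕ x′ ⊕ (g x 𝔽.* y 𝔽.+ g x′ 𝔽.* y) ⊛ z
          ≡⟨ cong (x ⊕ x′ ⊕_) (⊛-distribʳ-+ _ _ z) ⟩
        x ⊕ x′ ⊕ ((g x 𝔽.* y) ⊛ z ⊕ (g x′ 𝔽.* y) ⊛ z)
          ≡⟨ ⊕-interchange x x′ _ _ ⟩
        A x ⊕ A x′ ∎

      A-* : ∀ c x → A (c ⊛ x) ≡ c ⊛ A x
      A-* c x = begin
        c ⊛ x ⊕ (g (c ⊛ x) 𝔽.* y) ⊛ z
          ≡⟨ cong (λ e → c ⊛ x ⊕ e ⊛ z) (trans (cong (𝔽._* y) (g-* c x)) (𝔽.*-assoc c _ y)) ⟩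
        c ⊛ x ⊕ (c 𝔽.* (g x 𝔽.* y)) ⊛ z
          ≡⟨ cong (c ⊛ x ⊕_) (⊛-assoc c _ z) ⟩
        c ⊛ x ⊕ c ⊛ ((g x 𝔽.* y) ⊛ z)
          ≡⟨ ⊛-distribˡ-⊕ c x _ ⟨
        c ⊛ A x ∎

      Aw≡w′ : A w ≡ w′
      Aw≡w′ = begin
        w ⊕ (g w 𝔽.* y) ⊛ z  ≡⟨ cong (λ c → w ⊕ c ⊛ z) fw*y≡1 ⟩
        w ⊕ 1# ⊛ z           ≡⟨ cong (w ⊕_) (⊛-identityˡ z) ⟩
        w ⊕ z                ≡⟨ x⊕[y⊕⊝x]≡y w w′ ⟩
        w′                   ∎

      1+yz : 1# 𝔽.+ y 𝔽.* g z ≡ g w′ 𝔽.* y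
      1+yz = begin
        1# 𝔽.+ y 𝔽.* g z           ≡⟨ cong₂ 𝔽._+_ (sym fw*y≡1) (𝔽.*-comm y (g z)) ⟩
        g w 𝔽.* y 𝔽.+ g z 𝔽.* y    ≡⟨ 𝔽.distribʳ y (g w) (g z) ⟨
        (g w 𝔽.+ g z) 𝔽.* y        ≡⟨ cong (𝔽._* y) (g-+ w z) ⟨
        g (w ⊕ z) 𝔽.* y            ≡⟨ cong (λ v → g v 𝔽.* y) (x⊕[y⊕⊝x]≡y w w′) ⟩
        g w′ 𝔽.* y                 ∎

      gA : ∀ x → g (A x) ≡ g x 𝔽.* (g w′ 𝔽.* y)
      gA x = begin
        g (A x)                              ≡⟨ g-+ x _ ⟩
        g x 𝔽.+ g ((g x 𝔽.* y) ⊛ z)          ≡⟨ cong₂ 𝔽._+_ (sym (𝔽.*-identityʳ (g x)))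
                                                  (trans (g-* _ z) (𝔽.*-assoc (g x) y (g z))) ⟩
        g x 𝔽.* 1# 𝔽.+ g x 𝔽.* (y 𝔽.* g z)   ≡⟨ 𝔽.distribˡ (g x) 1# _ ⟨
        g x 𝔽.* (1# 𝔽.+ y 𝔽.* g z)           ≡⟨ cong (g x 𝔽.*_) 1+yz ⟩
        g x 𝔽.* (g w′ 𝔽.* y)                 ∎

      invertible : (g w′ 𝔽.* y) 𝔽.* (g w 𝔽.* y′) ≡ 1#
      invertible = begin
        (g w′ 𝔽.* y) 𝔽.* (g w 𝔽.* y′)  ≡⟨ cong (𝔽._* (g w 𝔽.* y′)) (𝔽.*-comm (g w′) y) ⟩
        (y 𝔽.* g w′) 𝔽.* (g w 𝔽.* y′)  ≡⟨ *-interchange y (g w′) (g w) y′ ⟩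
        (y 𝔽.* g w) 𝔽.* (g w′ 𝔽.* y′)  ≡⟨ cong₂ 𝔽._*_ (trans (𝔽.*-comm y (g w)) fw*y≡1) fw′*y′≡1 ⟩
        1# 𝔽.* 1#                      ≡⟨ 𝔽.*-identityˡ 1# ⟩
        1#                             ∎
        where
        *-interchange : ∀ a b c d → (a 𝔽.* b) 𝔽.* (c 𝔽.* d) ≡ (a 𝔽.* c) 𝔽.* (b 𝔽.* d)
        *-interchange = interchangeOf (record
          { isCommutativeSemigroup = record { isSemigroup = 𝔽.*-isSemigroup ; comm = 𝔽.*-comm } })

      A-kernel : ∀ x → A x ≡ 𝟎 → x ≡ 𝟎
      A-kernel x Ax≡𝟎 = begin
        x        ≡⟨ ⊕-𝟎ʳ x ⟨
        x ⊕ 𝟎    ≡⟨ cong (x ⊕_) (trans (cong (_⊛ z) (trans (cong (𝔽._* y) gx≡0) (𝔽.zeroˡ y))) (⊛-zeroˡ z)) ⟨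
        A x      ≡⟨ Ax≡𝟎 ⟩
        𝟎        ∎
        where
        g𝟎≡0 : g 𝟎 ≡ 0#
        g𝟎≡0 = trans (cong g (sym (⊛-zeroˡ 𝟎))) (trans (g-* 0# 𝟎) (𝔽.zeroˡ _))
        gx≡0 : g x ≡ 0#
        gx≡0 = *-cancel invertible (trans (sym (gA x)) (trans (cong g Ax≡𝟎) g𝟎≡0))

-- Transport of subspaces along linear maps, incidence counts and numbers of splittings

module Faces (𝔽 : FiniteField) (n : ℕ) where
  open VectorSpace 𝔽
  open FiniteField 𝔽 using (Carrier; 0#; order; finite)
  open Grassmann 𝔽 n hiding (_⊕_; _⊛_; 𝟎; ⊝_; combination; ⊕-𝟎ʳ; ⊕-𝟎ˡ; ⊕-⊝)

  private
    variable
      s t : ℕ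

  funToFin-cong : ∀ {k l} {f g : Fin k → Fin l} → (∀ i → f i ≡ g i) → funToFin f ≡ funToFin g
  funToFin-cong {zero}  f≗g = refl
  funToFin-cong {suc k} f≗g = cong₂ combine (f≗g Fin.zero) (funToFin-cong (f≗g ∘ Fin.suc))

  -- Opaque, as unfolding the decision procedures of Defs is prohibitively slow.
  abstract
    unindex : Fin (order ℕ.^ n) → V
    unindex k = Vec.tabulate (λ i → Inverse.from finite (finToFun k i))

    index-unindex : ∀ k → index (unindex k) ≡ k
    index-unindex k = trans
      (funToFin-cong {g = finToFun {order} {n} k}
        (λ i → trans (cong (Inverse.to finite)
                           (Vecₚ.lookup∘tabulate (λ i → Inverse.from finite (finToFun k i)) i))
                     (Inverse.strictlyInverseˡ finite _)))
      (Finₚ.funToFin-finToFin {n} k)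

    unindex-index : ∀ x → unindex (index x) ≡ x
    unindex-index x = trans
      (Vecₚ.tabulate-cong (λ i → trans (cong (Inverse.from finite) (Finₚ.finToFun-funToFin _ i))
                                       (Inverse.strictlyInverseʳ finite _)))
      (Vecₚ.tabulate∘lookup x)

    comprehension : {P : V → Set} → (∀ x → Dec (P x)) → VSubset
    comprehension P? = Vec.tabulate (λ k → does (P? (unindex k)))

    ∈-comprehension⁺ : ∀ {P : V → Set} (P? : ∀ x → Dec (P x)) x → P x → x ∈ᵥ comprehension P?
    ∈-comprehension⁺ {P} P? x p = Vecₚ.lookup⇒[]= (index x) _
      (trans (Vecₚ.lookup∘tabulate (λ k → does (P? (unindex k))) (index x))
             (dec-true (P? _) (subst P (sym (unindex-index x)) p)))

    ∈-comprehension⁻ : ∀ {P : V → Set} (P? : ∀ x → Dec (P x)) x → x ∈ᵥ comprehension P? → P x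
    ∈-comprehension⁻ {P} P? x x∈ with P? (unindex (index x))
      | trans (sym (Vecₚ.lookup∘tabulate (λ k → does (P? (unindex k))) (index x))) (Vecₚ.[]=⇒lookup x∈)
    ... | yes p | _ = subst P (unindex-index x) p
    ... | no _  | ()

  extensionality : ∀ {U W} → (∀ x → x ∈ᵥ U → x ∈ᵥ W) → (∀ x → x ∈ᵥ W → x ∈ᵥ U) → U ≡ W
  extensionality {U} {W} U⊆W W⊆U = ⊆-antisym
    (λ {k} k∈U → subst (_∈ W) (index-unindex k) (U⊆W (unindex k) (subst (_∈ U) (sym (index-unindex k)) k∈U)))
    (λ {k} k∈W → subst (_∈ U) (index-unindex k) (W⊆U (unindex k) (subst (_∈ W) (sym (index-unindex k)) k∈W)))

  abstract
    -- The stored proof is irrelevant, so the decision procedure is rerun to obtain a usable basis.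
    -- The result depends on `u` alone and thus fixes one basis for each face.
    isFace : (u : Face t) → IsFace t (value u)
    isFace {t} (u , [ p ]) = recompute (isFace? t u) p

    isDisjoint : (e : Edge t) → Disjoint (value e)
    isDisjoint (e , [ p ]) = recompute (disjoint? e) p

  Face-≡ : {u v : Face t} → value u ≡ value v → u ≡ v
  Face-≡ refl = refl

  face-combination : ∀ {U d} → IsFace t U → (c : Vec Carrier d) (b : Vec V d) →
                     (∀ i → lookup b i ∈ᵥ U) → combination c b ∈ᵥ U
  face-combination ((𝟎∈ , _) , _) []       []       b∈ = 𝟎∈
  face-combination {U = U} fU@((_ , ⊕∈ , ⊛∈) , _) (c ∷ cs) (b ∷ bs) b∈ =
    ⊕∈ (c ⊛ b) (combination cs bs) (⊛∈ c b (b∈ Fin.zero)) (face-combination fU cs bs (b∈ ∘ Fin.suc))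

  coordinates : ∀ {U} → IsFace t U → LinearInjection t n
  coordinates (_ , b , _ , _ , independent) = record
    { _$_    = λ c → combination c b
    ; +-homo = λ x y → combination-⊕ x y b
    ; *-homo = λ c x → combination-⊛ c x b
    ; kernel = independent
    }

  coordinates∈ : ∀ {U} (fU : IsFace t U) c → (coordinates fU $ c) ∈ᵥ U
  coordinates∈ fU@(_ , b , b∈ , _) c = face-combination fU c b b∈

  ImageContains : ∀ {d} → LinearInjection d n → VSubset → Set
  ImageContains p U = ∀ x → x ∈ᵥ U → ∃[ c ] (p $ c) ≡ x

  -- Carries subsets of the image of p to subsets of the image of p′ along p′ ∘ p⁻¹.
  module Transport {d} (p p′ : LinearInjection d n) where

    Transported : VSubset → V → Set
    Transported U y = ∃[ c ] ((p′ $ c) ≡ y × (p $ c) ∈ᵥ U)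

    transported? : ∀ U y → Dec (Transported U y)
    transported? U y = any-Vec any-Carrier d (λ c → ((p′ $ c) ≟ᵥ y) ×-dec ((p $ c) ∈ᵥ? U))

    transport : VSubset → VSubset
    transport U = comprehension (transported? U)

    module _ {U : VSubset} where

      transport⁻ : ∀ y → y ∈ᵥ transport U → Transported U y
      transport⁻ = ∈-comprehension⁻ (transported? U)

      transport-$⁺ : ∀ c → (p $ c) ∈ᵥ U → (p′ $ c) ∈ᵥ transport U
      transport-$⁺ c c∈ = ∈-comprehension⁺ (transported? U) (p′ $ c) (c , refl , c∈)

      transport-$⁻ : ∀ c → (p′ $ c) ∈ᵥ transport U → (p $ c) ∈ᵥ U
      transport-$⁻ c c∈ with transport⁻ _ c∈
      ... | c′ , e , c′∈ = subst (λ z → (p $ z) ∈ᵥ U) (injective p′ e) c′∈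

    -- Transport forgets the points outside the image of `p`, hence the two containments; on the
    -- image it is undone by injectivity of `p′`.
    transport-injective : ∀ {U W} → ImageContains p U → ImageContains p W →
                          transport U ≡ transport W → U ≡ W
    transport-injective {U} {W} imU imW e = extensionality (half⊆ imU e) (half⊆ imW (sym e))
      where
      half⊆ : ∀ {U W} → ImageContains p U → transport U ≡ transport W → ∀ x → x ∈ᵥ U → x ∈ᵥ W
      half⊆ imU e x x∈ with imU x x∈
      ... | c , refl = transport-$⁻ c (subst ((p′ $ c) ∈ᵥ_) e (transport-$⁺ c x∈))

    -- A basis of `U` is pulled back through `p` and pushed forward through `p′`. Both maps are
    -- injective and linear, so they preserve and reflect linear relations.
    transport-isFace : ∀ {U} → ImageContains p U → IsFace t U → IsFace t (transport U)
    transport-isFace {t} {U} im ((𝟎∈ , ⊕∈ , ⊛∈) , b , b∈ , span , independent) =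
      (𝟎∈′ , ⊕∈′ , ⊛∈′) , Vec.map (p′ $_) a , b′∈ , span′ , independent′
      where
      𝟎∈′ : 𝟎 ∈ᵥ transport U
      𝟎∈′ = subst (_∈ᵥ transport U) (𝟎-homo p′) (transport-$⁺ 𝟎 (subst (_∈ᵥ U) (sym (𝟎-homo p)) 𝟎∈))
      ⊕∈′ : ∀ x y → x ∈ᵥ transport U → y ∈ᵥ transport U → x ⊕ y ∈ᵥ transport U
      ⊕∈′ x y x∈ y∈ with transport⁻ x x∈ | transport⁻ y y∈
      ... | c , refl , c∈ | e , refl , e∈ = subst (_∈ᵥ transport U) (+-homo p′ c e)
        (transport-$⁺ (c ⊕ e) (subst (_∈ᵥ U) (sym (+-homo p c e)) (⊕∈ (p $ c) (p $ e) c∈ e∈)))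
      ⊛∈′ : ∀ k x → x ∈ᵥ transport U → k ⊛ x ∈ᵥ transport U
      ⊛∈′ k x x∈ with transport⁻ x x∈
      ... | c , refl , c∈ = subst (_∈ᵥ transport U) (*-homo p′ k c)
        (transport-$⁺ (k ⊛ c) (subst (_∈ᵥ U) (sym (*-homo p k c)) (⊛∈ k (p $ c) c∈)))
      preimage : ∀ {k} (b : Vec V k) → (∀ i → lookup b i ∈ᵥ U) → ∃[ a ] Vec.map (p $_) a ≡ b
      preimage []       b∈ = [] , refl
      preimage (x ∷ xs) b∈ with im x (b∈ Fin.zero) | preimage xs (b∈ ∘ Fin.suc)
      ... | c , e | cs , es = c ∷ cs , cong₂ _∷_ e es
      a : Vec (Vec Carrier d) t
      a = proj₁ (preimage b b∈)
      pa≡b : Vec.map (p $_) a ≡ b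
      pa≡b = proj₂ (preimage b b∈)
      p-combination : ∀ c → (p $ combination c a) ≡ combination c b
      p-combination c = trans (combination-homo p c a) (cong (combination c) pa≡b)
      b′∈ : ∀ i → lookup (Vec.map (p′ $_) a) i ∈ᵥ transport U
      b′∈ i = subst (_∈ᵥ transport U) (sym (Vecₚ.lookup-map i (p′ $_) a)) (transport-$⁺ (lookup a i)
        (subst (_∈ᵥ U) (trans (cong (λ z → lookup z i) (sym pa≡b)) (Vecₚ.lookup-map i (p $_) a)) (b∈ i)))
      span′ : ∀ x → x ∈ᵥ transport U → Σ[ c ∈ Vec Carrier t ] combination c (Vec.map (p′ $_) a) ≡ x
      span′ x x∈ with transport⁻ x x∈
      ... | c , refl , c∈ with span (p $ c) c∈
      ... | k , e = k , trans (sym (combination-homo p′ k a))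
                              (cong (p′ $_) (injective p (trans (p-combination k) e)))
      independent′ : ∀ c → combination c (Vec.map (p′ $_) a) ≡ 𝟎 → c ≡ replicate t 0#
      independent′ c e = independent c (trans (sym (p-combination c))
        (trans (cong (p $_) (kernel p′ _ (trans (combination-homo p′ c a) e))) (𝟎-homo p)))

  splitting⊆ : ∀ {T : Face s} {u v w : Face t} → IsSplitting T (u , v , w) →
    (∀ x → x ∈ꟳ u → x ∈ꟳ T) × (∀ x → x ∈ꟳ v → x ∈ꟳ T) × (∀ x → x ∈ꟳ w → x ∈ꟳ T)
  splitting⊆ {T = T} {u} {v} {w} (sums , _) =
      (λ x x∈ → subst (_∈ꟳ T) (trans (⊕-𝟎ʳ _) (⊕-𝟎ʳ x)) (sums x 𝟎 𝟎 x∈ (𝟎∈ v) (𝟎∈ w)))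
    , (λ x x∈ → subst (_∈ꟳ T) (trans (⊕-𝟎ʳ _) (⊕-𝟎ˡ x)) (sums 𝟎 x 𝟎 (𝟎∈ u) x∈ (𝟎∈ w)))
    , (λ x x∈ → subst (_∈ꟳ T) (trans (cong (_⊕ x) (⊕-𝟎ˡ 𝟎)) (⊕-𝟎ˡ x)) (sums 𝟎 𝟎 x (𝟎∈ u) (𝟎∈ v) x∈))
    where
    𝟎∈ : (u : Face t) → 𝟎 ∈ꟳ u
    𝟎∈ u = IsFace-𝟎 (isFace u)

  -- The chosen bases of `T` and `T′` give an isomorphism between them. Since the summands of a
  -- splitting lie inside `T`, it acts on them without being extended to the ambient space.
  module TransportSplitting (T T′ : Face s) where
    p p′ : LinearInjection s n
    p  = coordinates (isFace T)
    p′ = coordinates (isFace T′)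

    open Transport p p′ public

    image : ∀ {U} → (∀ x → x ∈ᵥ U → x ∈ꟳ T) → ImageContains p U
    image U⊆T x x∈ = let _ , _ , _ , span , _ = isFace T in span x (U⊆T x x∈)

    transportFace : (u : Face t) → (∀ x → x ∈ꟳ u → x ∈ꟳ T) → Face t
    transportFace u u⊆T = transport (value u) , [ transport-isFace (image u⊆T) (isFace u) ]

    transport-isSplitting : ∀ {u v w : Face t} (u⊆ : ∀ x → x ∈ꟳ u → x ∈ꟳ T) (v⊆ : ∀ x → x ∈ꟳ v → x ∈ꟳ T)
      (w⊆ : ∀ x → x ∈ꟳ w → x ∈ꟳ T) → IsSplitting T (u , v , w) →
      IsSplitting T′ (transportFace u u⊆ , transportFace v v⊆ , transportFace w w⊆)
    transport-isSplitting {u = u} {v} {w} u⊆ v⊆ w⊆ (_ , decompose , direct) = sums′ , decompose′ , direct′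
      where
      homo₃ : (l : LinearInjection s n) → ∀ a b c → (l $ (a ⊕ b ⊕ c)) ≡ (l $ a) ⊕ (l $ b) ⊕ (l $ c)
      homo₃ l a b c = trans (+-homo l (a ⊕ b) c) (cong (_⊕ (l $ c)) (+-homo l a b))
      sums′ : ∀ a b c → a ∈ᵥ transport (value u) → b ∈ᵥ transport (value v) → c ∈ᵥ transport (value w) →
              a ⊕ b ⊕ c ∈ꟳ T′
      sums′ a b c a∈ b∈ c∈ with transport⁻ a a∈ | transport⁻ b b∈ | transport⁻ c c∈
      ... | α , refl , _ | β , refl , _ | γ , refl , _ =
        subst (_∈ꟳ T′) (homo₃ p′ α β γ) (coordinates∈ (isFace T′) (α ⊕ β ⊕ γ))
      decompose′ : ∀ x → x ∈ꟳ T′ → Σ[ a ∈ V ] Σ[ b ∈ V ] Σ[ c ∈ V ]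
        (a ∈ᵥ transport (value u) × b ∈ᵥ transport (value v) × c ∈ᵥ transport (value w) × a ⊕ b ⊕ c ≡ x)
      decompose′ x x∈ with (let _ , _ , _ , span , _ = isFace T′ in span x x∈)
      ... | k , refl with decompose (p $ k) (coordinates∈ (isFace T) k)
      ... | a , b , c , a∈ , b∈ , c∈ , e with image u⊆ a a∈ | image v⊆ b b∈ | image w⊆ c c∈
      ... | α , refl | β , refl | γ , refl =
        (p′ $ α) , (p′ $ β) , (p′ $ γ)
        , transport-$⁺ α a∈ , transport-$⁺ β b∈ , transport-$⁺ γ c∈
        , trans (sym (homo₃ p′ α β γ))
                (cong (p′ $_) {α ⊕ β ⊕ γ} {k} (injective p {α ⊕ β ⊕ γ} {k} (trans (homo₃ p α β γ) e)))
      direct′ : ∀ a b c → a ∈ᵥ transport (value u) → b ∈ᵥ transport (value v) → c ∈ᵥ transport (value w) →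
                a ⊕ b ⊕ c ≡ 𝟎 → a ≡ 𝟎 × b ≡ 𝟎 × c ≡ 𝟎
      direct′ a b c a∈ b∈ c∈ e with transport⁻ a a∈ | transport⁻ b b∈ | transport⁻ c c∈
      ... | α , refl , α∈ | β , refl , β∈ | γ , refl , γ∈
        with direct (p $ α) (p $ β) (p $ γ) α∈ β∈ γ∈
               (trans (sym (homo₃ p α β γ))
                      (trans (cong (p $_) (kernel p′ (α ⊕ β ⊕ γ) (trans (homo₃ p′ α β γ) e))) (𝟎-homo p)))
      ... | α≡ , β≡ , γ≡ = zero′ α α≡ , zero′ β β≡ , zero′ γ γ≡
        where
        zero′ : ∀ x → (p $ x) ≡ 𝟎 → (p′ $ x) ≡ 𝟎
        zero′ x e = trans (cong (p′ $_) (kernel p x e)) (𝟎-homo p′)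

  scalars : List Carrier
  scalars = List.tabulate (Inverse.from finite)

  scalars-complete : ∀ c → c List∈.∈ scalars
  scalars-complete c = subst (List∈._∈ scalars) (Inverse.strictlyInverseʳ finite c)
                             (∈-tabulate⁺ (Inverse.to finite c))

  scalars-unique : Unique scalars
  scalars-unique = Uniqueₚ.tabulate⁺ (Injection.injective (↔⇒↣ (↔-sym finite)))

  length-vectors-scalars : ∀ d → length (vectors scalars d) ≡ order ℕ.^ d
  length-vectors-scalars d = trans (length-vectors scalars d) (cong (ℕ._^ d) (length-tabulate _))

  faces-complete : (u : Face t) → u List∈.∈ faces t
  faces-complete {t} u = select-complete (isFace? t) (isFace u) (vectors-complete
    (λ { inside → here refl ; outside → there (here refl) }) (value u))

  faces-unique : ∀ t → Unique (faces t)
  faces-unique t = select-unique (isFace? t)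
    (vectors-unique (((λ ()) ∷ []) ∷ [] ∷ []) (order ℕ.^ n))

  _≟ˢ_ : (U W : VSubset) → Dec (U ≡ W)
  _≟ˢ_ = Vecₚ.≡-dec Boolₚ._≟_

  -- Related to each vector are its coordinates in the basis of `u`, and these determine the vector.
  face-size : (u : Face t) → ∑ (vectors scalars n) (λ w → ⟦ w ∈ᵥ? value u ⟧) ≤ order ℕ.^ t
  face-size {t} u = begin
    ∑ (vectors scalars n) (λ w → ⟦ w ∈ᵥ? value u ⟧)
      ≤⟨ ∑-injective (vectors scalars t) (vectors-unique scalars-unique n) (λ w → w ∈ᵥ? value u)
           (λ _ → yes tt) (λ w c → (coordinates (isFace u) $ c) ≟ᵥ w)
           (λ w w∈ → let _ , _ , _ , span , _ = isFace u
                         c , e = span w w∈ in c , vectors-complete scalars-complete c , tt , e)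
           (λ _ _ e _ e′ → trans (sym e) e′) ⟩
    ∑ (vectors scalars t) (λ _ → 1)
      ≡⟨ ∑-const (vectors scalars t) 1 ⟩
    length (vectors scalars t) ℕ.* 1
      ≡⟨ trans (ℕₚ.*-identityʳ _) (length-vectors-scalars t) ⟩
    order ℕ.^ t ∎
    where open ℕₚ.≤-Reasoning

  #faces∋ : ℕ → V → ℕ
  #faces∋ t w = ∑ (faces t) (λ u → ⟦ w ∈ᵥ? value u ⟧)

  -- A linear automorphism mapping w to w′ injects the faces through w into those
  -- through w′; for w′ = 𝟎 every face counts.
  #faces∋-≤ : ∀ {w} → w ≢ 𝟎 → ∀ w′ → #faces∋ t w ≤ #faces∋ t w′
  #faces∋-≤ {t} {w} w≢𝟎 w′ with w′ ≟ᵥ 𝟎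
  ... | yes refl = ∑-mono (faces t) λ u → ⟦⟧-≤ (w ∈ᵥ? value u)
        (λ _ → ℕₚ.≤-reflexive (sym (⟦⟧-true (𝟎 ∈ᵥ? value u) (IsFace-𝟎 (isFace u)))))
  ... | no w′≢𝟎 with transvection w w′ w≢𝟎 w′≢𝟎
  ... | A , Aw≡w′ = ∑-injective (faces t) (faces-unique t) (λ u → w ∈ᵥ? value u) (λ u → w′ ∈ᵥ? value u)
        (λ u u′ → transport (value u) ≟ˢ value u′)
        (λ u w∈ → let u′ = transport (value u) , [ transport-isFace (λ x _ → x , refl) (isFace u) ] in
          u′ , faces-complete u′ , subst (_∈ᵥ transport (value u)) Aw≡w′ (transport-$⁺ w w∈) , refl)
        (λ _ _ e _ e′ → Face-≡ (transport-injective (λ x _ → x , refl) (λ x _ → x , refl) (trans e (sym e′))))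
    where open Transport identity A

  -- A random face contains a given nonzero vector with probability at most `q ^ (t - n)`. By
  -- `#faces∋-≤` a nonzero vector lies in no more faces than any other vector, hence in no more than
  -- the average over all `q ^ n` vectors, and each face contributes at most `q ^ t` incidences to
  -- that average.
  #faces∋-bound : ∀ {w} → w ≢ 𝟎 → order ℕ.^ n ℕ.* #faces∋ t w ≤ length (faces t) ℕ.* order ℕ.^ t
  #faces∋-bound {t} {w} w≢𝟎 = begin
    order ℕ.^ n ℕ.* #faces∋ t w
      ≡⟨ cong (ℕ._* #faces∋ t w) (length-vectors-scalars n) ⟨
    length (vectors scalars n) ℕ.* #faces∋ t w
      ≡⟨ ∑-const (vectors scalars n) _ ⟨
    ∑ (vectors scalars n) (λ _ → #faces∋ t w)
      ≤⟨ ∑-mono (vectors scalars n) (#faces∋-≤ w≢𝟎) ⟩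
    ∑ (vectors scalars n) (#faces∋ t)
      ≡⟨ ∑-swap (vectors scalars n) (faces t) _ ⟩
    ∑ (faces t) (λ u → ∑ (vectors scalars n) (λ w → ⟦ w ∈ᵥ? value u ⟧))
      ≤⟨ ∑-mono (faces t) face-size ⟩
    ∑ (faces t) (λ _ → order ℕ.^ t)
      ≡⟨ ∑-const (faces t) _ ⟩
    length (faces t) ℕ.* order ℕ.^ t ∎
    where open ℕₚ.≤-Reasoning

  triples : ∀ t → List (Face t × Face t × Face t)
  triples t = cartesianProduct (faces t) (cartesianProduct (faces t) (faces t))

  -- Transport from `T` to `T′` turns splittings into splittings, injectively.
  #splittings-≤ : (T T′ : Face s) → length (splittings t T) ≤ length (splittings t T′)
  #splittings-≤ {t = t} T T′ = subst₂ _≤_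
    (sym (length-select (isSplitting? T) (triples t))) (sym (length-select (isSplitting? T′) (triples t)))
    (∑-injective (triples t) triples-unique (isSplitting? T) (isSplitting? T′)
      -- The relation compares underlying sets: transported faces require containment in `T`, which
      -- is known for splittings but not for arbitrary triples.
      {R = λ (u , v , w) (u′ , v′ , w′) → transport (value u) ≡ value u′
             × transport (value v) ≡ value v′ × transport (value w) ≡ value w′}
      (λ (u , v , w) (u′ , v′ , w′) → (transport (value u) ≟ˢ value u′)
             ×-dec (transport (value v) ≟ˢ value v′) ×-dec (transport (value w) ≟ˢ value w′))
      (λ (u , v , w) split → let u⊆ , v⊆ , w⊆ = splitting⊆ {T = T} {u} {v} {w} split in
        (transportFace u u⊆ , transportFace v v⊆ , transportFace w w⊆)
        , triples-complete _
        , transport-isSplitting {u = u} {v} {w} u⊆ v⊆ w⊆ split , refl , refl , refl)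
      (λ {uvw} {uvw′} _ → injective₃ uvw uvw′))
    where
    open TransportSplitting T T′
    triples-unique : Unique (triples t)
    triples-unique = Uniqueₚ.cartesianProduct⁺ (faces-unique t)
                       (Uniqueₚ.cartesianProduct⁺ (faces-unique t) (faces-unique t))
    triples-complete : ∀ uvw → uvw List∈.∈ triples t
    triples-complete (u , v , w) = ∈-cartesianProduct⁺ (faces-complete u)
                                     (∈-cartesianProduct⁺ (faces-complete v) (faces-complete w))
    injective₃ : ∀ ((u , v , w) (u′ , v′ , w′) : Face t × Face t × Face t) {U V W : VSubset} →
      IsSplitting T (u , v , w) →
      transport (value u) ≡ U × transport (value v) ≡ V × transport (value w) ≡ W →
      IsSplitting T (u′ , v′ , w′) →
      transport (value u′) ≡ U × transport (value v′) ≡ V × transport (value w′) ≡ W →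
      (u , v , w) ≡ (u′ , v′ , w′)
    injective₃ (u , v , w) (u′ , v′ , w′) split (refl , refl , refl) split′ (eu , ev , ew) =
      let u⊆  , v⊆  , w⊆  = splitting⊆ {T = T} {u} {v} {w} split
          u′⊆ , v′⊆ , w′⊆ = splitting⊆ {T = T} {u′} {v′} {w′} split′
      in cong₂ _,_ (Face-≡ (transport-injective (image u⊆) (image u′⊆) (sym eu)))
          (cong₂ _,_ (Face-≡ (transport-injective (image v⊆) (image v′⊆) (sym ev)))
                     (Face-≡ (transport-injective (image w⊆) (image w′⊆) (sym ew))))

  -- This makes the two-stage choice of a triangle uniform over all pairs of a space and a
  -- splitting.
  #splittings-≡ : (T T′ : Face s) → length (splittings t T) ≡ length (splittings t T′)
  #splittings-≡ T T′ = ℕₚ.≤-antisym (#splittings-≤ T T′) (#splittings-≤ T′ T)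

-- Direct sums and a lower bound for the number of direct triples

module DirectSums (𝔽 : FiniteField) (n : ℕ) where
  open VectorSpace 𝔽
  open FiniteField 𝔽 using (Carrier; 0#; order)
  open Grassmann 𝔽 n hiding (_⊕_; _⊛_; 𝟎; ⊝_; combination; ⊕-𝟎ʳ; ⊕-𝟎ˡ; ⊕-⊝; direct)
  open Faces 𝔽 n

  private
    variable
      s t : ℕ

  -- The relation `Disjoint` for bare subsets, so that a `t`-space can be compared with a sum of
  -- dimension `2t`.
  MeetTrivially : VSubset → VSubset → Set
  MeetTrivially U W = ∀ x → x ∈ᵥ U → x ∈ᵥ W → x ≡ 𝟎

  meetTrivially? : ∀ U W → Dec (MeetTrivially U W)
  meetTrivially? U W = for-all any-V λ x → (x ∈ᵥ? U) →-dec ((x ∈ᵥ? W) →-dec (x ≟ᵥ 𝟎))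

  IsSum : VSubset → VSubset → V → Set
  IsSum U W x = Σ[ a ∈ V ] Σ[ b ∈ V ] (a ∈ᵥ U × b ∈ᵥ W × a ⊕ b ≡ x)

  isSum? : ∀ U W x → Dec (IsSum U W x)
  isSum? U W x = any-V λ a → any-V λ b → (a ∈ᵥ? U) ×-dec (b ∈ᵥ? W) ×-dec ((a ⊕ b) ≟ᵥ x)

  infixl 6 _+ˢ_

  _+ˢ_ : VSubset → VSubset → VSubset
  U +ˢ W = comprehension (isSum? U W)

  module _ {U W : VSubset} where

    +ˢ⁺ : ∀ a b → a ∈ᵥ U → b ∈ᵥ W → a ⊕ b ∈ᵥ U +ˢ W
    +ˢ⁺ a b a∈ b∈ = ∈-comprehension⁺ (isSum? U W) (a ⊕ b) (a , b , a∈ , b∈ , refl)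

    +ˢ⁻ : ∀ x → x ∈ᵥ U +ˢ W → IsSum U W x
    +ˢ⁻ = ∈-comprehension⁻ (isSum? U W)

  -- If the sum is zero then `a` equals `⊝ b`, which lies in both spaces.
  direct-sum : ∀ {U W} → IsFace s U → IsFace t W → MeetTrivially U W →
               ∀ a b → a ∈ᵥ U → b ∈ᵥ W → a ⊕ b ≡ 𝟎 → a ≡ 𝟎 × b ≡ 𝟎
  direct-sum {W = W} fU fW disj a b a∈ b∈ a⊕b≡𝟎 = a≡𝟎 , (begin
    b      ≡⟨ ⊕-𝟎ˡ b ⟨
    𝟎 ⊕ b  ≡⟨ cong (_⊕ b) a≡𝟎 ⟨
    a ⊕ b  ≡⟨ a⊕b≡𝟎 ⟩
    𝟎      ∎)
    where
    open ≡-Reasoning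
    ⊝b≡a : ⊝ b ≡ a
    ⊝b≡a = sym (x⊕⊝y≡𝟎⇒x≡y a (⊝ b) (begin
      a ⊕ ⊝ (⊝ b)                    ≡⟨ ⊕-𝟎ˡ _ ⟨
      𝟎 ⊕ (a ⊕ ⊝ (⊝ b))              ≡⟨ cong (_⊕ (a ⊕ ⊝ (⊝ b))) (⊝⊕ b) ⟨
      (⊝ b ⊕ b) ⊕ (a ⊕ ⊝ (⊝ b))      ≡⟨ ⊕-comm _ _ ⟩
      (a ⊕ ⊝ (⊝ b)) ⊕ (⊝ b ⊕ b)      ≡⟨ cong ((a ⊕ ⊝ (⊝ b)) ⊕_) (⊕-comm (⊝ b) b) ⟩
      (a ⊕ ⊝ (⊝ b)) ⊕ (b ⊕ ⊝ b)      ≡⟨ ⊕-interchange a (⊝ (⊝ b)) b (⊝ b) ⟩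
      (a ⊕ b) ⊕ (⊝ (⊝ b) ⊕ ⊝ b)      ≡⟨ cong₂ _⊕_ a⊕b≡𝟎 (⊝⊕ (⊝ b)) ⟩
      𝟎 ⊕ 𝟎                          ≡⟨ ⊕-𝟎ˡ 𝟎 ⟩
      𝟎                              ∎))
    a≡𝟎 : a ≡ 𝟎
    a≡𝟎 = disj a a∈ (subst (_∈ᵥ W) ⊝b≡a (IsFace-⊝ fW b b∈))

  +ˢ-isFace : ∀ {U W} → IsFace s U → IsFace t W → MeetTrivially U W → IsFace (s ℕ.+ t) (U +ˢ W)
  +ˢ-isFace {s} {t} {U} {W} fU@((𝟎∈U , ⊕∈U , ⊛∈U) , b , b∈ , span , independent)
                            fW@((𝟎∈W , ⊕∈W , ⊛∈W) , b′ , b′∈ , span′ , independent′) disj =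
    (𝟎∈ , ⊕∈ , ⊛∈) , b Vec.++ b′ , b++b′∈ , spanning , independence
    where
    𝟎∈ : 𝟎 ∈ᵥ U +ˢ W
    𝟎∈ = subst (_∈ᵥ U +ˢ W) (⊕-𝟎ˡ 𝟎) (+ˢ⁺ 𝟎 𝟎 𝟎∈U 𝟎∈W)
    ⊕∈ : ∀ x y → x ∈ᵥ U +ˢ W → y ∈ᵥ U +ˢ W → x ⊕ y ∈ᵥ U +ˢ W
    ⊕∈ x y x∈ y∈ with +ˢ⁻ x x∈ | +ˢ⁻ y y∈
    ... | a , c , a∈ , c∈ , refl | a′ , c′ , a′∈ , c′∈ , refl = subst (_∈ᵥ U +ˢ W)
      (⊕-interchange a a′ c c′) (+ˢ⁺ (a ⊕ a′) (c ⊕ c′) (⊕∈U a a′ a∈ a′∈) (⊕∈W c c′ c∈ c′∈))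
    ⊛∈ : ∀ k x → x ∈ᵥ U +ˢ W → k ⊛ x ∈ᵥ U +ˢ W
    ⊛∈ k x x∈ with +ˢ⁻ x x∈
    ... | a , c , a∈ , c∈ , refl = subst (_∈ᵥ U +ˢ W) (sym (⊛-distribˡ-⊕ k a c))
      (+ˢ⁺ (k ⊛ a) (k ⊛ c) (⊛∈U k a a∈) (⊛∈W k c c∈))
    b++b′∈ : ∀ i → lookup (b Vec.++ b′) i ∈ᵥ U +ˢ W
    b++b′∈ i = subst (_∈ᵥ U +ˢ W) (sym (Vecₚ.lookup-splitAt s b b′ i)) (either (Fin.splitAt s i))
      where
      either : ∀ j → Sum.[ lookup b , lookup b′ ]′ j ∈ᵥ U +ˢ W
      either (inj₁ j) = subst (_∈ᵥ U +ˢ W) (⊕-𝟎ʳ (lookup b j)) (+ˢ⁺ (lookup b j) 𝟎 (b∈ j) 𝟎∈W)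
      either (inj₂ j) = subst (_∈ᵥ U +ˢ W) (⊕-𝟎ˡ (lookup b′ j)) (+ˢ⁺ 𝟎 (lookup b′ j) 𝟎∈U (b′∈ j))
    spanning : ∀ x → x ∈ᵥ U +ˢ W → Σ[ c ∈ Vec Carrier (s ℕ.+ t) ] combination c (b Vec.++ b′) ≡ x
    spanning x x∈ with +ˢ⁻ x x∈
    ... | a , a′ , a∈ , a′∈ , refl with span a a∈ | span′ a′ a′∈
    ... | c , refl | c′ , refl = c Vec.++ c′ , combination-++ c c′ b b′
    independence : ∀ c → combination c (b Vec.++ b′) ≡ 𝟎 → c ≡ replicate (s ℕ.+ t) 0#
    independence c e with Vec.splitAt s c
    ... | k , k′ , refl with direct-sum fU fW disj (combination k b) (combination k′ b′)
                               (face-combination fU k b b∈) (face-combination fW k′ b′ b′∈)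
                               (trans (sym (combination-++ k k′ b b′)) e)
    ... | e₁ , e₂ = trans (cong₂ Vec._++_ (independent k e₁) (independent′ k′ e₂)) (𝟎-++ s)

  -- The product `3 * t` unfolds to `t + (t + (t + 0))`, which differs from the dimension of an
  -- iterated sum by the trailing zero.
  3t-dimensional : ∀ {U} → IsFace (t ℕ.+ (t ℕ.+ t)) U → IsFace (3 ℕ.* t) U
  3t-dimensional {t} {U} = subst (λ d → IsFace d U) (cong (λ z → t ℕ.+ (t ℕ.+ z)) (sym (ℕₚ.+-identityʳ t)))

  -- The criterion treats the middle space last, to match the count: the edge `(u , w)` is fixed and
  -- `v` varies.
  splitting-exists : ((u , v , w) : Face t × Face t × Face t) → Disjoint (u , w) →
    MeetTrivially (value v) (value u +ˢ value w) → Σ[ T ∈ Face (3 ℕ.* t) ] IsSplitting T (u , v , w)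
  splitting-exists {t} (u , v , w) u∩w v∩[u+w] = T , sums , decompose , direct
    where
    U+W = value u +ˢ value w
    U+W-isFace : IsFace (t ℕ.+ t) U+W
    U+W-isFace = +ˢ-isFace (isFace u) (isFace w) u∩w
    T : Face (3 ℕ.* t)
    T = value v +ˢ U+W , [ 3t-dimensional {t} (+ˢ-isFace (isFace v) U+W-isFace v∩[u+w]) ]
    rotate : ∀ (a b c : V) → b ⊕ (a ⊕ c) ≡ a ⊕ b ⊕ c
    rotate a b c = trans (sym (⊕-assoc b a c)) (cong (_⊕ c) (⊕-comm b a))
    sums : ∀ a b c → a ∈ꟳ u → b ∈ꟳ v → c ∈ꟳ w → a ⊕ b ⊕ c ∈ꟳ T
    sums a b c a∈ b∈ c∈ = subst (_∈ꟳ T) (rotate a b c) (+ˢ⁺ b (a ⊕ c) b∈ (+ˢ⁺ a c a∈ c∈))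
    decompose : ∀ x → x ∈ꟳ T → Σ[ a ∈ V ] Σ[ b ∈ V ] Σ[ c ∈ V ]
                                 (a ∈ꟳ u × b ∈ꟳ v × c ∈ꟳ w × a ⊕ b ⊕ c ≡ x)
    decompose x x∈ with +ˢ⁻ x x∈
    ... | b , y , b∈ , y∈ , refl with +ˢ⁻ y y∈
    ... | a , c , a∈ , c∈ , refl = a , b , c , a∈ , b∈ , c∈ , sym (rotate a b c)
    direct : ∀ a b c → a ∈ꟳ u → b ∈ꟳ v → c ∈ꟳ w → a ⊕ b ⊕ c ≡ 𝟎 → a ≡ 𝟎 × b ≡ 𝟎 × c ≡ 𝟎
    direct a b c a∈ b∈ c∈ e with direct-sum (isFace v) U+W-isFace v∩[u+w] b (a ⊕ c) b∈ (+ˢ⁺ a c a∈ c∈)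
                                            (trans (rotate a b c) e)
    ... | b≡𝟎 , a⊕c≡𝟎 with direct-sum (isFace u) (isFace w) u∩w a c a∈ c∈ a⊕c≡𝟎
    ... | a≡𝟎 , c≡𝟎 = a≡𝟎 , b≡𝟎 , c≡𝟎

  -- A space is recovered from a splitting as the set of sums, so no triple is counted under two
  -- different spaces.
  splitting-unique : {T T′ : Face s} (uvw : Face t × Face t × Face t) →
                     IsSplitting T uvw → IsSplitting T′ uvw → T ≡ T′
  splitting-unique {s} {T = T} {T′} (u , v , w) split split′ =
    Face-≡ (extensionality (includes T T′ split split′) (includes T′ T split′ split))
    where
    includes : (T T′ : Face s) → IsSplitting T (u , v , w) → IsSplitting T′ (u , v , w) →
               ∀ x → x ∈ꟳ T → x ∈ꟳ T′
    includes _ _ (_ , decompose , _) (sums , _) x x∈ with decompose x x∈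
    ... | a , b , c , a∈ , b∈ , c∈ , refl = sums a b c a∈ b∈ c∈

  -- Union bound: a face that meets `W` nontrivially contains one of the at most `q ^ s` nonzero
  -- vectors of `W`, enumerated here by their coordinates.
  #meeting-bound : ∀ {W} → IsFace s W →
    order ℕ.^ n ℕ.* ∑ (faces t) (λ v → ⟦ ¬? (meetTrivially? (value v) W) ⟧)
      ≤ order ℕ.^ s ℕ.* (length (faces t) ℕ.* order ℕ.^ t)
  #meeting-bound {s} {t} {W} fW = begin
    order ℕ.^ n ℕ.* ∑ (faces t) (λ v → ⟦ ¬? (meetTrivially? (value v) W) ⟧)
      ≤⟨ ℕₚ.*-monoʳ-≤ (order ℕ.^ n) (begin
        ∑ (faces t) (λ v → ⟦ ¬? (meetTrivially? (value v) W) ⟧)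
          ≤⟨ ∑-mono (faces t) (λ v → ⟦⟧-≤ (¬? (meetTrivially? (value v) W)) (meeting-vector v)) ⟩
        ∑ (faces t) (λ v → ∑ (vectors scalars s) (λ c → ⟦ nonzero? c ⟧ ℕ.* ⟦ (p $ c) ∈ᵥ? value v ⟧))
          ≡⟨ ∑-swap (faces t) (vectors scalars s) _ ⟩
        ∑ (vectors scalars s) (λ c → ∑ (faces t) (λ v → ⟦ nonzero? c ⟧ ℕ.* ⟦ (p $ c) ∈ᵥ? value v ⟧))
          ≡⟨ ∑-cong (vectors scalars s) (λ c → ∑-*ˡ (faces t) ⟦ nonzero? c ⟧ _) ⟩
        ∑ (vectors scalars s) (λ c → ⟦ nonzero? c ⟧ ℕ.* #faces∋ t (p $ c)) ∎) ⟩
    order ℕ.^ n ℕ.* ∑ (vectors scalars s) (λ c → ⟦ nonzero? c ⟧ ℕ.* #faces∋ t (p $ c))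
      ≡⟨ ∑-*ˡ (vectors scalars s) (order ℕ.^ n) _ ⟨
    ∑ (vectors scalars s) (λ c → order ℕ.^ n ℕ.* (⟦ nonzero? c ⟧ ℕ.* #faces∋ t (p $ c)))
      -- The factor `⟦ nonzero? c ⟧` removes the zero vector, which lies in every face and would
      -- spoil the bound.
      ≤⟨ ∑-mono (vectors scalars s) (λ c → ℕₚ.≤-trans
           (ℕₚ.≤-reflexive (x∙yz≈y∙xz (order ℕ.^ n) ⟦ nonzero? c ⟧ (#faces∋ t (p $ c))))
           (⟦⟧-* (nonzero? c) #faces∋-bound)) ⟩
    ∑ (vectors scalars s) (λ c → length (faces t) ℕ.* order ℕ.^ t)
      ≡⟨ ∑-const (vectors scalars s) _ ⟩
    length (vectors scalars s) ℕ.* (length (faces t) ℕ.* order ℕ.^ t)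
      ≡⟨ cong (ℕ._* (length (faces t) ℕ.* order ℕ.^ t)) (length-vectors-scalars s) ⟩
    order ℕ.^ s ℕ.* (length (faces t) ℕ.* order ℕ.^ t) ∎
    where
    open ℕₚ.≤-Reasoning
    open import Algebra.Properties.CommutativeSemigroup ℕₚ.*-commutativeSemigroup using (x∙yz≈y∙xz)
    p : LinearInjection s n
    p = coordinates fW
    nonzero? : ∀ c → Dec ((p $ c) ≢ 𝟎)
    nonzero? c = ¬? ((p $ c) ≟ᵥ 𝟎)
    meeting-vector : ∀ v → ¬ MeetTrivially (value v) W →
      1 ≤ ∑ (vectors scalars s) (λ c → ⟦ nonzero? c ⟧ ℕ.* ⟦ (p $ c) ∈ᵥ? value v ⟧)
    meeting-vector v meet with any-Vec any-Carrier s (λ c → nonzero? c ×-dec ((p $ c) ∈ᵥ? value v))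
    ... | yes (c , ≢𝟎 , c∈) = ℕₚ.≤-trans
          (ℕₚ.≤-reflexive (sym (cong₂ ℕ._*_ (⟦⟧-true (nonzero? c) ≢𝟎) (⟦⟧-true ((p $ c) ∈ᵥ? value v) c∈))))
          (≤-∑ (λ c → ⟦ nonzero? c ⟧ ℕ.* ⟦ (p $ c) ∈ᵥ? value v ⟧) (vectors-complete scalars-complete c))
    ... | no none = contradiction trivial meet
      where
      trivial : MeetTrivially (value v) W
      trivial x x∈v x∈W with x ≟ᵥ 𝟎
      ... | yes x≡𝟎 = x≡𝟎
      ... | no x≢𝟎 with (let _ , _ , _ , span , _ = fW in span x x∈W)
      ... | c , refl = contradiction (c , x≢𝟎 , x∈v) none

  -- Triples list the middle space second, but both counts over triples need the outer pair
  -- separated from it: one varies the middle space over a fixed edge, the other the edge for a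
  -- fixed middle space.
  ∑-triples : ∀ (f : Face t × Face t × Face t → ℕ) →
    ∑ (triples t) f ≡ ∑ (cartesianProduct (faces t) (faces t)) (λ (u , w) → ∑ (faces t) (λ v → f (u , v , w)))
  ∑-triples {t} f = begin
    ∑ (triples t) f
      ≡⟨ ∑-cartesianProduct (faces t) _ f ⟩
    ∑ (faces t) (λ u → ∑ (cartesianProduct (faces t) (faces t)) (λ vw → f (u , vw)))
      ≡⟨ ∑-cong (faces t) (λ u → trans (∑-cartesianProduct (faces t) (faces t) _) (∑-swap (faces t) (faces t) _)) ⟩
    ∑ (faces t) (λ u → ∑ (faces t) (λ w → ∑ (faces t) (λ v → f (u , v , w))))
      ≡⟨ ∑-cartesianProduct (faces t) (faces t) _ ⟨
    ∑ (cartesianProduct (faces t) (faces t)) (λ (u , w) → ∑ (faces t) (λ v → f (u , v , w))) ∎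
    where open ≡-Reasoning

  #triangles : ℕ → ℕ
  #triangles t = ∑ (faces (3 ℕ.* t)) (λ T → length (splittings t T))

  -- Among pairs of an edge `(u , w)` and a face `v`, the proportion of direct triples is at least
  -- `1 - q ^ (3t - n)`: apply `#meeting-bound` to the `2t`-dimensional sum of `u` and `w`, edge by
  -- edge. Denominators are cleared by `q ^ n`.
  #triangles-≥ : order ℕ.^ n ℕ.* (length (edges t) ℕ.* length (faces t))
    ≤ order ℕ.^ n ℕ.* #triangles t
        ℕ.+ length (edges t) ℕ.* (order ℕ.^ (t ℕ.+ t) ℕ.* (length (faces t) ℕ.* order ℕ.^ t))
  #triangles-≥ {t} = begin
    Q ℕ.* (E ℕ.* N)
      ≡⟨ cong (Q ℕ.*_) (∑-const (edges t) N) ⟨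
    Q ℕ.* ∑ (edges t) (λ _ → N)
      ≡⟨ ∑-*ˡ (edges t) Q _ ⟨
    ∑ (edges t) (λ _ → Q ℕ.* N)
      ≤⟨ ∑-mono (edges t) transverse ⟩
    ∑ (edges t) (λ e → Q ℕ.* #transverse (value e) ℕ.+ R)
      ≡⟨ ∑-+ (edges t) _ _ ⟩
    ∑ (edges t) (λ e → Q ℕ.* #transverse (value e)) ℕ.+ ∑ (edges t) (λ _ → R)
      ≡⟨ cong₂ ℕ._+_ (∑-*ˡ (edges t) Q _) (∑-const (edges t) R) ⟩
    Q ℕ.* ∑ (edges t) (λ e → #transverse (value e)) ℕ.+ E ℕ.* R
      ≤⟨ ℕₚ.+-monoˡ-≤ (E ℕ.* R) (ℕₚ.*-monoʳ-≤ Q transverse-≤) ⟩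
    Q ℕ.* #triangles t ℕ.+ E ℕ.* R ∎
    where
    open ℕₚ.≤-Reasoning
    Q = order ℕ.^ n
    E = length (edges t)
    N = length (faces t)
    R = order ℕ.^ (t ℕ.+ t) ℕ.* (N ℕ.* order ℕ.^ t)

    transverse? : ∀ ((u , v , w) : Face t × Face t × Face t) → Dec (MeetTrivially (value v) (value u +ˢ value w))
    transverse? (u , v , w) = meetTrivially? (value v) (value u +ˢ value w)

    #transverse : Face t × Face t → ℕ
    #transverse (u , w) = ∑ (faces t) (λ v → ⟦ transverse? (u , v , w) ⟧)

    complement : ∀ {P : Set} (P? : Dec P) → 1 ≡ ⟦ P? ⟧ ℕ.+ ⟦ ¬? P? ⟧
    complement (yes _) = refl
    complement (no _)  = refl

    transverse : ∀ e → Q ℕ.* N ≤ Q ℕ.* #transverse (value e) ℕ.+ R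
    transverse e@((u , w) , _) = begin
      Q ℕ.* N
        ≡⟨ cong (Q ℕ.*_) (trans (sym (ℕₚ.*-identityʳ N)) (sym (∑-const (faces t) 1))) ⟩
      Q ℕ.* ∑ (faces t) (λ _ → 1)
        ≡⟨ cong (Q ℕ.*_) (trans (∑-cong (faces t) (λ v → complement (transverse? (u , v , w))))
                                (∑-+ (faces t) _ _)) ⟩
      Q ℕ.* (#transverse (u , w) ℕ.+ ∑ (faces t) (λ v → ⟦ ¬? (transverse? (u , v , w)) ⟧))
        ≡⟨ ℕₚ.*-distribˡ-+ Q _ _ ⟩
      Q ℕ.* #transverse (u , w) ℕ.+ Q ℕ.* ∑ (faces t) (λ v → ⟦ ¬? (transverse? (u , v , w)) ⟧)
        ≤⟨ ℕₚ.+-monoʳ-≤ _ (#meeting-bound (+ˢ-isFace (isFace u) (isFace w) (isDisjoint e))) ⟩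
      Q ℕ.* #transverse (u , w) ℕ.+ R ∎

    transverse-≤ : ∑ (edges t) (λ e → #transverse (value e)) ≤ #triangles t
    transverse-≤ = begin
      ∑ (edges t) (λ e → #transverse (value e))
        ≡⟨ ∑-select disjoint? (cartesianProduct (faces t) (faces t)) #transverse ⟩
      ∑ (cartesianProduct (faces t) (faces t)) (λ uw → ⟦ disjoint? uw ⟧ ℕ.* #transverse uw)
        ≡⟨ ∑-cong (cartesianProduct (faces t) (faces t)) (λ uw → sym (∑-*ˡ (faces t) ⟦ disjoint? uw ⟧ _)) ⟩
      ∑ (cartesianProduct (faces t) (faces t))
        (λ (u , w) → ∑ (faces t) (λ v → ⟦ disjoint? (u , w) ⟧ ℕ.* ⟦ transverse? (u , v , w) ⟧))
        ≡⟨ ∑-triples (λ (u , v , w) → ⟦ disjoint? (u , w) ⟧ ℕ.* ⟦ transverse? (u , v , w) ⟧) ⟨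
      ∑ (triples t) (λ (u , v , w) → ⟦ disjoint? (u , w) ⟧ ℕ.* ⟦ transverse? (u , v , w) ⟧)
        ≤⟨ ∑-mono (triples t) (λ uvw@(u , v , w) →
             ⟦⟧-* (disjoint? (u , w)) (λ u∩w → ⟦⟧-≤ (transverse? uvw) (λ v∩[u+w] →
               let T , split = splitting-exists uvw u∩w v∩[u+w] in
               ℕₚ.≤-trans (ℕₚ.≤-reflexive (sym (⟦⟧-true (isSplitting? T uvw) split)))
                          (≤-∑ (λ T → ⟦ isSplitting? T uvw ⟧) (faces-complete T))))) ⟩
      ∑ (triples t) (λ uvw → ∑ (faces (3 ℕ.* t)) (λ T → ⟦ isSplitting? T uvw ⟧))
        ≡⟨ ∑-swap (faces (3 ℕ.* t)) (triples t) _ ⟨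
      ∑ (faces (3 ℕ.* t)) (λ T → ∑ (triples t) (λ uvw → ⟦ isSplitting? T uvw ⟧))
        ≡⟨ ∑-cong (faces (3 ℕ.* t)) (λ T → sym (length-select (isSplitting? T) (triples t))) ⟩
      #triangles t ∎

-- From rational probabilities to counts

private
  variable
    A : Set
    P : A → Set

ι : ℕ → ℚ
ι n = ℤ.+ n ℚ./ 1

/-cong : ∀ a b j k → a ℕ.* suc k ≡ b ℕ.* suc j → (ℤ.+ a ℚ./ suc j) ≡ (ℤ.+ b ℚ./ suc k)
/-cong a b j k e = ℚₚ.≤-antisym (/-mono a b j k (ℕₚ.≤-reflexive e)) (/-mono b a k j (ℕₚ.≤-reflexive (sym e)))

ι-suc : ∀ n → ι (suc n) ≡ ι n ℚ.+ 1ℚ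
ι-suc n = suc-/ n 0

ι-+ : ∀ m n → ι (m ℕ.+ n) ≡ ι m ℚ.+ ι n
ι-+ zero    n = sym (ℚₚ.+-identityˡ (ι n))
ι-+ (suc m) n = begin
  ι (suc (m ℕ.+ n))       ≡⟨ ι-suc (m ℕ.+ n) ⟩
  ι (m ℕ.+ n) ℚ.+ 1ℚ      ≡⟨ cong (ℚ._+ 1ℚ) (ι-+ m n) ⟩
  ι m ℚ.+ ι n ℚ.+ 1ℚ      ≡⟨ xy∙z≈xz∙y (ι m) (ι n) 1ℚ ⟩
  ι m ℚ.+ 1ℚ ℚ.+ ι n      ≡⟨ cong (ℚ._+ ι n) (ι-suc m) ⟨
  ι (suc m) ℚ.+ ι n       ∎
  where
  open ≡-Reasoning
  xy∙z≈xz∙y : ∀ x y z → x ℚ.+ y ℚ.+ z ≡ x ℚ.+ z ℚ.+ y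
  xy∙z≈xz∙y = solve 3 (λ x y z → x :+ y :+ z := x :+ z :+ y) refl
    where open ℚ-Solver.+-*-Solver

ι-* : ∀ m n → ι (m ℕ.* n) ≡ ι m ℚ.* ι n
ι-* zero    n = sym (ℚₚ.*-zeroˡ (ι n))
ι-* (suc m) n = begin
  ι (n ℕ.+ m ℕ.* n)            ≡⟨ ι-+ n (m ℕ.* n) ⟩
  ι n ℚ.+ ι (m ℕ.* n)          ≡⟨ cong₂ ℚ._+_ (sym (ℚₚ.*-identityˡ (ι n))) (ι-* m n) ⟩
  1ℚ ℚ.* ι n ℚ.+ ι m ℚ.* ι n   ≡⟨ ℚₚ.*-distribʳ-+ (ι n) 1ℚ (ι m) ⟨
  (1ℚ ℚ.+ ι m) ℚ.* ι n         ≡⟨ cong (ℚ._* ι n) (trans (ℚₚ.+-comm 1ℚ (ι m)) (sym (ι-suc m))) ⟩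
  ι (suc m) ℚ.* ι n            ∎
  where open ≡-Reasoning

ι-mono : ∀ {m n} → m ≤ n → ι m ℚ.≤ ι n
ι-mono {m} {n} m≤n = /-mono m n 0 0 (ℕₚ.*-monoˡ-≤ 1 m≤n)

ι-positive : ∀ {n} → 0 ℕ.< n → 0ℚ ℚ.< ι n
ι-positive 0<n = ℚₚ.<-≤-trans 0<1 (ι-mono 0<n)

1/n*ι : ∀ k m → (ℤ.+ 1 ℚ./ suc k) ℚ.* ι m ≡ ℤ.+ m ℚ./ suc k
1/n*ι k zero    = trans (ℚₚ.*-zeroʳ (ℤ.+ 1 ℚ./ suc k)) (/-cong 0 0 0 k refl)
1/n*ι k (suc m) = begin
  (ℤ.+ 1 ℚ./ suc k) ℚ.* ι (suc m)                             ≡⟨ cong ((ℤ.+ 1 ℚ./ suc k) ℚ.*_) (ι-suc m) ⟩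
  (ℤ.+ 1 ℚ./ suc k) ℚ.* (ι m ℚ.+ 1ℚ)                          ≡⟨ ℚₚ.*-distribˡ-+ (ℤ.+ 1 ℚ./ suc k) (ι m) 1ℚ ⟩
  (ℤ.+ 1 ℚ./ suc k) ℚ.* ι m ℚ.+ (ℤ.+ 1 ℚ./ suc k) ℚ.* 1ℚ        ≡⟨ cong₂ ℚ._+_ (1/n*ι k m)
                                                                     (ℚₚ.*-identityʳ (ℤ.+ 1 ℚ./ suc k)) ⟩
  (ℤ.+ m ℚ./ suc k) ℚ.+ (ℤ.+ 1 ℚ./ suc k)                       ≡⟨ suc-/ m k ⟨
  ℤ.+ suc m ℚ./ suc k                                         ∎
  where open ≡-Reasoning

1/n*ιn : ∀ k → (ℤ.+ 1 ℚ./ suc k) ℚ.* ι (suc k) ≡ 1ℚ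
1/n*ιn k = trans (1/n*ι k (suc k))
  (/-cong (suc k) 1 k 0 (trans (ℕₚ.*-identityʳ (suc k)) (sym (ℕₚ.*-identityˡ (suc k)))))

-- If all values of `f` are fractions over one denominator `c`, their average is a fraction over
-- `length xs * c`. The junk value for the empty list fits, as the numerator is then 0.
𝔼-scale : ∀ c (xs : List A) {f : A → ℚ} {g : A → ℕ} → (∀ x → f x ℚ.* ι c ≡ ι (g x)) →
          𝔼 xs f ℚ.* ι (length xs ℕ.* c) ≡ ι (∑ xs g)
𝔼-scale c []            h = ℚₚ.*-zeroˡ (ι 0)
𝔼-scale c xs@(_ ∷ ys) {f} {g} h = begin
  total xs ℚ.* r ℚ.* ι (length xs ℕ.* c)       ≡⟨ cong (total xs ℚ.* r ℚ.*_) (ι-* (length xs) c) ⟩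
  total xs ℚ.* r ℚ.* (ι (length xs) ℚ.* ι c)   ≡⟨ rearrange (total xs) r (ι (length xs)) (ι c) ⟩
  r ℚ.* ι (length xs) ℚ.* (total xs ℚ.* ι c)   ≡⟨ cong₂ ℚ._*_ (1/n*ιn (length ys)) (scaled xs) ⟩
  1ℚ ℚ.* ι (∑ xs g)                            ≡⟨ ℚₚ.*-identityˡ _ ⟩
  ι (∑ xs g)                                   ∎
  where
  open ≡-Reasoning
  r = ℤ.+ 1 ℚ./ suc (length ys)
  total : List _ → ℚ
  total zs = List.foldr ℚ._+_ 0ℚ (List.map f zs)
  rearrange : ∀ a b c d → a ℚ.* b ℚ.* (c ℚ.* d) ≡ b ℚ.* c ℚ.* (a ℚ.* d)
  rearrange = solve 4 (λ a b c d → a :* b :* (c :* d) := b :* c :* (a :* d)) refl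
    where open ℚ-Solver.+-*-Solver
  scaled : ∀ zs → total zs ℚ.* ι c ≡ ι (∑ zs g)
  scaled []       = ℚₚ.*-zeroˡ (ι c)
  scaled (z ∷ zs) = trans (ℚₚ.*-distribʳ-+ (ι c) (f z) (total zs))
                    (trans (cong₂ ℚ._+_ (h z) (scaled zs)) (sym (ι-+ (g z) (∑ zs g))))

Pr-scale : ∀ (xs : List A) (P? : ∀ x → Dec (P x)) →
           Pr xs P? ℚ.* ι (length xs) ≡ ι (∑ xs (λ x → ⟦ P? x ⟧))
Pr-scale xs P? = trans (cong (λ l → Pr xs P? ℚ.* ι l) (sym (ℕₚ.*-identityʳ (length xs))))
                       (𝔼-scale 1 xs (λ x → indicator (P? x)))
  where
  indicator : ∀ {Q : Set} (Q? : Dec Q) → (if does Q? then 1ℚ else 0ℚ) ℚ.* ι 1 ≡ ι ⟦ Q? ⟧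
  indicator (yes _) = refl
  indicator (no _)  = refl

-- Were no term positive, the sum would not be positive either. Applied to `Pr-triangle`, this
-- produces the space and the splitting that show the relevant lists to be nonempty.
positive-term : ∀ (xs : List A) (f : A → ℚ) → 0ℚ ℚ.< 𝔼 xs f → ∃[ x ] (x List∈.∈ xs × 0ℚ ℚ.< f x)
positive-term []            f 0<𝔼 = contradiction 0<𝔼 (ℚₚ.<-irrefl refl)
positive-term xs@(_ ∷ ys) f 0<𝔼 = go xs (ℚₚ.*-cancelʳ-<-nonNeg r {{r-nonNeg}}
    (subst (ℚ._< total xs ℚ.* r) (sym (ℚₚ.*-zeroˡ r)) 0<𝔼))
  where
  r = ℤ.+ 1 ℚ./ suc (length ys)
  r-nonNeg : ℚ.NonNegative r
  r-nonNeg = ℚ.nonNegative (/-mono 0 1 0 (length ys) z≤n)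
  total : List _ → ℚ
  total zs = List.foldr ℚ._+_ 0ℚ (List.map f zs)
  go : ∀ zs → 0ℚ ℚ.< total zs → ∃[ z ] (z List∈.∈ zs × 0ℚ ℚ.< f z)
  go []       0<0 = contradiction 0<0 (ℚₚ.<-irrefl refl)
  go (z ∷ zs) 0<t with 0ℚ ℚₚ.<? f z
  ... | yes 0<fz = z , here refl , 0<fz
  ... | no 0≮fz with go zs (ℚₚ.<-≤-trans 0<t (ℚₚ.≤-trans (ℚₚ.+-monoˡ-≤ (total zs) (ℚₚ.≮⇒≥ 0≮fz))
                                                       (ℚₚ.≤-reflexive (ℚₚ.+-identityˡ (total zs)))))
  ... | y , y∈ , 0<fy = y , there y∈ , 0<fy

-- With `X = G / D` and `Y = a / E`, the natural-number hypothesis is the conclusion multiplied by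
-- `D * E * suc Q`.
ratio-≤ : ∀ {X Y D E G a} Q → 0 ℕ.< D → 0 ℕ.< E → X ℚ.* ι D ≡ ι G → Y ℚ.* ι E ≡ ι a →
          G ℕ.* E ℕ.* suc Q ≤ D ℕ.* a ℕ.* suc Q ℕ.+ D ℕ.* E → X ℚ.≤ Y ℚ.+ (ℤ.+ 1 ℚ./ suc Q)
ratio-≤ {X} {Y} {D} {E} {G} {a} Q 0<D 0<E X*D Y*E G≤ = ℚₚ.*-cancelʳ-≤-pos c {{ℚ.positive 0<c}} (begin
  X ℚ.* c                            ≡⟨ cong (X ℚ.*_) c≡ ⟩
  X ℚ.* (d ℚ.* e ℚ.* q)              ≡⟨ solve 4 (λ X d e q → X :* (d :* e :* q) := X :* d :* e :* q) refl X d e q ⟩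
  X ℚ.* d ℚ.* e ℚ.* q                ≡⟨ cong (λ z → z ℚ.* e ℚ.* q) X*D ⟩
  ι G ℚ.* e ℚ.* q                    ≡⟨ ι-*₃ G E (suc Q) ⟨
  ι (G ℕ.* E ℕ.* suc Q)              ≤⟨ ι-mono G≤ ⟩
  ι (D ℕ.* a ℕ.* suc Q ℕ.+ D ℕ.* E)  ≡⟨ ι-+ (D ℕ.* a ℕ.* suc Q) (D ℕ.* E) ⟩
  ι (D ℕ.* a ℕ.* suc Q) ℚ.+ ι (D ℕ.* E)
    ≡⟨ cong₂ ℚ._+_ (ι-*₃ D a (suc Q)) (ι-* D E) ⟩
  d ℚ.* ι a ℚ.* q ℚ.+ d ℚ.* e
    ≡⟨ cong₂ ℚ._+_ (cong (λ z → d ℚ.* z ℚ.* q) (sym Y*E))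
                   (trans (sym (ℚₚ.*-identityˡ (d ℚ.* e))) (cong (ℚ._* (d ℚ.* e)) (sym (1/n*ιn Q)))) ⟩
  d ℚ.* (Y ℚ.* e) ℚ.* q ℚ.+ r ℚ.* q ℚ.* (d ℚ.* e)
    ≡⟨ solve 5 (λ Y r d e q → d :* (Y :* e) :* q :+ r :* q :* (d :* e) := (Y :+ r) :* (d :* e :* q))
         refl Y r d e q ⟩
  (Y ℚ.+ r) ℚ.* (d ℚ.* e ℚ.* q)      ≡⟨ cong ((Y ℚ.+ r) ℚ.*_) c≡ ⟨
  (Y ℚ.+ r) ℚ.* c                    ∎)
  where
  open ℚₚ.≤-Reasoning
  open ℚ-Solver.+-*-Solver
  d = ι D
  e = ι E
  q = ι (suc Q)
  r = ℤ.+ 1 ℚ./ suc Q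
  c = ι (D ℕ.* E ℕ.* suc Q)
  ι-*₃ : ∀ x y z → ι (x ℕ.* y ℕ.* z) ≡ ι x ℚ.* ι y ℚ.* ι z
  ι-*₃ x y z = trans (ι-* (x ℕ.* y) z) (cong (ℚ._* ι z) (ι-* x y))
  c≡ : c ≡ d ℚ.* e ℚ.* q
  c≡ = ι-*₃ D E (suc Q)
  0<c : 0ℚ ℚ.< c
  0<c = ι-positive (ℕₚ.*-mono-< (ℕₚ.*-mono-< 0<D 0<E) (s≤s (z≤n {Q})))

-- The colouring by a fixed face and its average quality

module Colouring (𝔽 : FiniteField) (n : ℕ) {t m : ℕ}
                 (π : Grassmann.Edge 𝔽 n t → Permutation′ m)
                 (antisymmetric : Grassmann.Antisymmetric 𝔽 n π) where
  open FiniteField 𝔽 using (order; order-nonTrivial)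
  open Grassmann 𝔽 n
  open Faces 𝔽 n using (isDisjoint; faces-complete; faces-unique; #splittings-≡; triples)
  open DirectSums 𝔽 n using (#triangles; #triangles-≥; ∑-triples; splitting-unique)

  -- The value is junk when u meets v nontrivially.
  colour : Face t → Face t → Permutation′ m
  colour v u with disjoint? (u , v)
  ... | yes d = π ((u , v) , [ d ])
  ... | no _  = Perm.id

  colour-disjoint : ∀ u v (d : Disjoint (u , v)) → colour v u ≡ π ((u , v) , [ d ])
  colour-disjoint u v d with disjoint? (u , v)
  ... | yes _ = refl
  ... | no ¬d = contradiction d ¬d

  -- Asking for pairwise disjointness rather than directness makes sense without naming a sum `T`.
  -- It can only enlarge the set of consistent triples, which is harmless: these are bounded from
  -- above by satisfied edges.
  Good : Face t × Face t × Face t → Set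
  Good (u , v , w) = Σ[ d₁₂ ∈ Disjoint (u , v) ] Σ[ d₂₃ ∈ Disjoint (v , w) ] Σ[ d₁₃ ∈ Disjoint (u , w) ]
    ((π ((u , v) , [ d₁₂ ]) · π ((v , w) , [ d₂₃ ])) Perm.≈ π ((u , w) , [ d₁₃ ]))

  good? : ∀ uvw → Dec (Good uvw)
  good? (u , v , w) with disjoint? (u , v) | disjoint? (v , w) | disjoint? (u , w)
  ... | no ¬d₁₂ | _       | _       = no (λ (d , _) → ¬d₁₂ d)
  ... | yes _   | no ¬d₂₃ | _       = no (λ (_ , d , _) → ¬d₂₃ d)
  ... | yes _   | yes _   | no ¬d₁₃ = no (λ (_ , _ , d , _) → ¬d₁₃ d)
  ... | yes d₁₂ | yes d₂₃ | yes d₁₃ = map′ (λ h → d₁₂ , d₂₃ , d₁₃ , h) (λ (_ , _ , _ , h) → h)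
    ((π ((u , v) , [ d₁₂ ]) · π ((v , w) , [ d₂₃ ])) ≈? π ((u , w) , [ d₁₃ ]))

  agrees? : ∀ v (e : Edge t) → let (u , w) = value e in Dec (π e Perm.≈ (colour v u · colour v w ⁻¹))
  agrees? v e@((u , w) , _) = π e ≈? (colour v u · colour v w ⁻¹)

  -- By antisymmetry, `π(u,v) π(w,v)⁻¹ = π(u,v) π(v,w)`, and consistency turns this into `π(u,w)`.
  good⇒agrees : ∀ v (e : Edge t) → let (u , w) = value e in
                Good (u , v , w) → π e Perm.≈ (colour v u · colour v w ⁻¹)
  good⇒agrees v e@((u , w) , _) (d₁₂ , d₂₃ , _ , consistent) i
    rewrite colour-disjoint u v d₁₂ | colour-disjoint w v (λ x x∈w x∈v → d₂₃ x x∈v x∈w) =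
    trans (sym (consistent i)) (cong (π ((u , v) , [ d₁₂ ]) ⟨$⟩ʳ_) (antisymmetric ((v , w) , [ d₂₃ ]) i))

  #agreeing : Face t → ℕ
  #agreeing v = ∑ (edges t) (λ e → ⟦ agrees? v e ⟧)

  consistent? : ∀ T (uvw : Splitting t T) →
    Dec ((π (edge₁₂ {3 ℕ.* t} T uvw) · π (edge₂₃ T uvw)) Perm.≈ π (edge₁₃ T uvw))
  consistent? T uvw = (π (edge₁₂ T uvw) · π (edge₂₃ T uvw)) ≈? π (edge₁₃ T uvw)

  #consistent : Face (3 ℕ.* t) → ℕ
  #consistent T = ∑ (splittings t T) (λ uvw → ⟦ consistent? T uvw ⟧)

  -- A consistent splitting is a good triple, and `splitting-unique` prevents a triple from being
  -- counted for two spaces.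
  #good-≥ : ∑ (faces (3 ℕ.* t)) #consistent ≤ ∑ (triples t) (λ uvw → ⟦ good? uvw ⟧)
  #good-≥ = begin
    ∑ (faces (3 ℕ.* t)) #consistent
      ≤⟨ ∑-mono (faces (3 ℕ.* t)) (λ T → ∑-mono (splittings t T) (λ s → ⟦⟧-≤ (consistent? T s) (λ h →
           ℕₚ.≤-reflexive (sym (⟦⟧-true (good? (value s))
             (isDisjoint (edge₁₂ T s) , isDisjoint (edge₂₃ T s) , isDisjoint (edge₁₃ T s) , h)))))) ⟩
    ∑ (faces (3 ℕ.* t)) (λ T → ∑ (splittings t T) (λ s → ⟦ good? (value s) ⟧))
      ≡⟨ ∑-cong (faces (3 ℕ.* t)) (λ T → ∑-select (isSplitting? T) (triples t) (λ uvw → ⟦ good? uvw ⟧)) ⟩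
    ∑ (faces (3 ℕ.* t)) (λ T → ∑ (triples t) (λ uvw → ⟦ isSplitting? T uvw ⟧ ℕ.* ⟦ good? uvw ⟧))
      ≡⟨ ∑-swap (faces (3 ℕ.* t)) (triples t) _ ⟩
    ∑ (triples t) (λ uvw → ∑ (faces (3 ℕ.* t)) (λ T → ⟦ isSplitting? T uvw ⟧ ℕ.* ⟦ good? uvw ⟧))
      ≡⟨ ∑-cong (triples t) (λ uvw → ∑-*ʳ (faces (3 ℕ.* t)) ⟦ good? uvw ⟧ _) ⟩
    ∑ (triples t) (λ uvw → ∑ (faces (3 ℕ.* t)) (λ T → ⟦ isSplitting? T uvw ⟧) ℕ.* ⟦ good? uvw ⟧)
      ≤⟨ ∑-mono (triples t) (λ uvw → ℕₚ.*-monoˡ-≤ ⟦ good? uvw ⟧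
           (∑≤1 (faces-unique (3 ℕ.* t)) (λ T → isSplitting? T uvw)
                (λ {T} {T′} → splitting-unique {T = T} {T′} uvw))) ⟩
    ∑ (triples t) (λ uvw → 1 ℕ.* ⟦ good? uvw ⟧)
      ≡⟨ ∑-cong (triples t) (λ uvw → ℕₚ.*-identityˡ ⟦ good? uvw ⟧) ⟩
    ∑ (triples t) (λ uvw → ⟦ good? uvw ⟧) ∎
    where
    open ℕₚ.≤-Reasoning

  -- Grouped by their middle face `v`, good triples become edges satisfied by the colouring from
  -- `v`.
  #good-≤ : ∑ (triples t) (λ uvw → ⟦ good? uvw ⟧) ≤ ∑ (faces t) #agreeing
  #good-≤ = begin
    ∑ (triples t) (λ uvw → ⟦ good? uvw ⟧)
      ≡⟨ ∑-triples (λ uvw → ⟦ good? uvw ⟧) ⟩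
    ∑ pairs (λ (u , w) → ∑ (faces t) (λ v → ⟦ good? (u , v , w) ⟧))
      ≡⟨ ∑-swap pairs (faces t) _ ⟩
    ∑ (faces t) (λ v → ∑ pairs (λ (u , w) → ⟦ good? (u , v , w) ⟧))
      ≤⟨ ∑-mono (faces t) (λ v → ∑-mono pairs (λ (u , w) → ⟦⟧-≤ (good? (u , v , w)) (λ good →
           let _ , _ , d₁₃ , _ = good in ℕₚ.≤-reflexive (sym (cong₂ ℕ._*_
             (⟦⟧-true (disjoint? (u , w)) d₁₃) (⟦⟧-true (good? (u , v , w)) good)))))) ⟩
    ∑ (faces t) (λ v → ∑ pairs (λ (u , w) → ⟦ disjoint? (u , w) ⟧ ℕ.* ⟦ good? (u , v , w) ⟧))
      ≡⟨ ∑-cong (faces t) (λ v → ∑-select disjoint? pairs (λ (u , w) → ⟦ good? (u , v , w) ⟧)) ⟨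
    ∑ (faces t) (λ v → ∑ (edges t) (λ ((u , w) , _) → ⟦ good? (u , v , w) ⟧))
      ≤⟨ ∑-mono (faces t) (λ v → ∑-mono (edges t) (λ e@((u , w) , _) → ⟦⟧-≤ (good? (u , v , w)) (λ good →
           ℕₚ.≤-reflexive (sym (⟦⟧-true (agrees? v e) (good⇒agrees v e good)))))) ⟩
    ∑ (faces t) #agreeing ∎
    where
    open ℕₚ.≤-Reasoning
    pairs = cartesianProduct (faces t) (faces t)

  #consistent-≤ : ∑ (faces (3 ℕ.* t)) #consistent ≤ #triangles t
  #consistent-≤ = ∑-mono (faces (3 ℕ.* t)) (λ T → ℕₚ.≤-trans
    (∑-mono (splittings t T) (λ s → ⟦⟧≤1 (consistent? T s)))
    (ℕₚ.≤-reflexive (trans (∑-const (splittings t T) 1) (ℕₚ.*-identityʳ _))))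

  -- G / D = G / (E N) + (G / D) (1 - D / (E N)) ≤ a / E + 1 / Q, with the
  -- denominators cleared.
  averaging-arithmetic : ∀ {E N D G a Q} → 0 ℕ.< N → E ℕ.* N ℕ.* Q ≤ D ℕ.* Q ℕ.+ E ℕ.* N →
    G ≤ N ℕ.* a → G ≤ D → G ℕ.* E ℕ.* Q ≤ D ℕ.* a ℕ.* Q ℕ.+ D ℕ.* E
  averaging-arithmetic {E} {N} {D} {G} {a} {Q} 0<N direct G≤Na G≤D =
    ℕₚ.*-cancelʳ-≤ _ _ N {{ℕ.>-nonZero 0<N}} (begin
    G ℕ.* E ℕ.* Q ℕ.* N
      ≡⟨ solve 4 (λ G E Q N → G :* E :* Q :* N := G :* (E :* N :* Q)) refl G E Q N ⟩
    G ℕ.* (E ℕ.* N ℕ.* Q)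
      ≤⟨ ℕₚ.*-monoʳ-≤ G direct ⟩
    G ℕ.* (D ℕ.* Q ℕ.+ E ℕ.* N)
      ≡⟨ ℕₚ.*-distribˡ-+ G (D ℕ.* Q) (E ℕ.* N) ⟩
    G ℕ.* (D ℕ.* Q) ℕ.+ G ℕ.* (E ℕ.* N)
      ≤⟨ ℕₚ.+-mono-≤ (ℕₚ.*-monoˡ-≤ (D ℕ.* Q) G≤Na) (ℕₚ.*-monoˡ-≤ (E ℕ.* N) G≤D) ⟩
    N ℕ.* a ℕ.* (D ℕ.* Q) ℕ.+ D ℕ.* (E ℕ.* N)
      ≡⟨ solve 5 (λ N a D Q E → N :* a :* (D :* Q) :+ D :* (E :* N) := (D :* a :* Q :+ D :* E) :* N)
           refl N a D Q E ⟩
    (D ℕ.* a ℕ.* Q ℕ.+ D ℕ.* E) ℕ.* N ∎)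
    where
    open ℕₚ.≤-Reasoning
    open +-*-Solver

  private instance
    order-nonZero : ℕ.NonZero order
    order-nonZero = ℕ.nonTrivial⇒nonZero order {{order-nonTrivial}}

  -- This is `#triangles-≥` divided by `q ^ (3t)`; the assumption `3t ≤ n` allows the factor to be
  -- split off `q ^ n`.
  #triangles-≥′ : 3 ℕ.* t ≤ n → length (edges t) ℕ.* length (faces t) ℕ.* order ℕ.^ (n ∸ 3 ℕ.* t)
    ≤ #triangles t ℕ.* order ℕ.^ (n ∸ 3 ℕ.* t) ℕ.+ length (edges t) ℕ.* length (faces t)
  #triangles-≥′ 3t≤n = ℕₚ.*-cancelʳ-≤ _ _ R {{ℕₚ.m^n≢0 order (3 ℕ.* t)}} (begin
    E ℕ.* N ℕ.* Q ℕ.* R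
      ≡⟨ solve 4 (λ E N Q R → E :* N :* Q :* R := R :* Q :* (E :* N)) refl E N Q R ⟩
    R ℕ.* Q ℕ.* (E ℕ.* N)
      ≡⟨ cong (ℕ._* (E ℕ.* N)) RQ ⟩
    order ℕ.^ n ℕ.* (E ℕ.* N)
      ≤⟨ #triangles-≥ ⟩
    order ℕ.^ n ℕ.* D ℕ.+ E ℕ.* (order ℕ.^ (t ℕ.+ t) ℕ.* (N ℕ.* order ℕ.^ t))
      ≡⟨ cong₂ ℕ._+_ (cong (ℕ._* D) (sym RQ)) (cong (E ℕ.*_) (trans
           (solve 3 (λ x N y → x :* (N :* y) := N :* (y :* x)) refl (order ℕ.^ (t ℕ.+ t)) N (order ℕ.^ t))
           (cong (N ℕ.*_) R≡))) ⟩
    R ℕ.* Q ℕ.* D ℕ.+ E ℕ.* (N ℕ.* R)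
      ≡⟨ solve 5 (λ R Q D E N → R :* Q :* D :+ E :* (N :* R) := (D :* Q :+ E :* N) :* R) refl R Q D E N ⟩
    (D ℕ.* Q ℕ.+ E ℕ.* N) ℕ.* R ∎)
    where
    open ℕₚ.≤-Reasoning
    open +-*-Solver
    Q = order ℕ.^ (n ∸ 3 ℕ.* t)
    R = order ℕ.^ (3 ℕ.* t)
    E = length (edges t)
    N = length (faces t)
    D = #triangles t
    RQ : R ℕ.* Q ≡ order ℕ.^ n
    RQ = trans (sym (ℕₚ.^-distribˡ-+-* order (3 ℕ.* t) (n ∸ 3 ℕ.* t)))
               (cong (order ℕ.^_) (ℕₚ.m+[n∸m]≡n 3t≤n))
    R≡ : order ℕ.^ t ℕ.* order ℕ.^ (t ℕ.+ t) ≡ R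
    R≡ = trans (sym (ℕₚ.^-distribˡ-+-* order t (t ℕ.+ t)))
               (cong (λ z → order ℕ.^ (t ℕ.+ (t ℕ.+ z))) (sym (ℕₚ.+-identityʳ t)))

  -- Presents the power as a successor, as a rational denominator must be, and trades the error
  -- `q ^ (- k)` for the larger `1 / (1 + k)`.
  power-≥ : ∀ k → ∃[ Q ] (order ℕ.^ k ≡ suc Q × k ≤ Q)
  power-≥ k with order ℕ.^ k | LogarithmBounds.n<q^n order {{order-nonTrivial}} k
  ... | suc Q | s≤s k≤Q = Q , refl , k≤Q

  -- The given space and splitting make the numbers of faces, edges and triangles positive, so that
  -- every denominator can be cleared and cancelled.
  good-colouring-from : 3 ℕ.* t ≤ n → ∀ (T₀ : Face (3 ℕ.* t)) → T₀ List∈.∈ faces (3 ℕ.* t) →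
    ∀ (s₀ : Splitting t T₀) → s₀ List∈.∈ splittings t T₀ →
    Σ[ v ∈ Face t ] Pr-triangle π ℚ.≤ Pr-edge π (colour v) ℚ.+ (ℤ.+ 1 ℚ./ suc (n ∸ 3 ℕ.* t))
  good-colouring-from 3t≤n T₀ T₀∈ s₀@((u₀ , v₀ , w₀) , _) s₀∈ = v , ℚₚ.≤-trans
    (ratio-≤ {Pr-triangle π} {Pr-edge π (colour v)} {D} {E} {G} {#agreeing v}
      Q 0<D 0<E Pr-triangle-scale (Pr-scale (edges t) (agrees? v))
      (averaging-arithmetic {E} {N} {D} {G} {#agreeing v} {suc Q} 0<N
        (subst (λ q → E ℕ.* N ℕ.* q ≤ D ℕ.* q ℕ.+ E ℕ.* N) Q≡ (#triangles-≥′ 3t≤n))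
        (ℕₚ.≤-trans #good-≥ (ℕₚ.≤-trans #good-≤ ∑≤)) #consistent-≤))
    (ℚₚ.+-monoʳ-≤ (Pr-edge π (colour v)) (/-mono 1 1 Q (n ∸ 3 ℕ.* t) (ℕₚ.*-monoʳ-≤ 1 (s≤s k≤Q))))
    where
    E = length (edges t)
    N = length (faces t)
    D = #triangles t
    G = ∑ (faces (3 ℕ.* t)) #consistent
    v = proj₁ (∑-≤-length*max v₀ (faces t) #agreeing)
    ∑≤ : ∑ (faces t) #agreeing ≤ N ℕ.* #agreeing v
    ∑≤ = proj₂ (∑-≤-length*max v₀ (faces t) #agreeing)
    Q = proj₁ (power-≥ (n ∸ 3 ℕ.* t))
    Q≡ = proj₁ (proj₂ (power-≥ (n ∸ 3 ℕ.* t)))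
    k≤Q = proj₂ (proj₂ (power-≥ (n ∸ 3 ℕ.* t)))
    s = length (splittings t T₀)
    nonempty : ∀ {A : Set} {x : A} {xs} → x List∈.∈ xs → 0 ℕ.< length xs
    nonempty {xs = _ ∷ _} _ = s≤s z≤n
    D≡ : length (faces (3 ℕ.* t)) ℕ.* s ≡ D
    D≡ = trans (sym (∑-const (faces (3 ℕ.* t)) s)) (∑-cong (faces (3 ℕ.* t)) (#splittings-≡ T₀))
    0<D : 0 ℕ.< D
    0<D = subst (0 ℕ.<_) D≡ (ℕₚ.*-mono-< (nonempty T₀∈) (nonempty s₀∈))
    0<E : 0 ℕ.< E
    0<E = nonempty (select-complete disjoint? (isDisjoint (edge₁₂ T₀ s₀))
            (∈-cartesianProduct⁺ (faces-complete u₀) (faces-complete v₀)))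
    0<N : 0 ℕ.< N
    0<N = nonempty (faces-complete v₀)
    Pr-triangle-scale : Pr-triangle π ℚ.* ι D ≡ ι G
    Pr-triangle-scale = subst (λ d → Pr-triangle π ℚ.* ι d ≡ ι G) D≡
      -- The common denominator that `𝔼-scale` demands is the number of splittings of `T₀`, which
      -- every other `T` shares.
      (𝔼-scale s (faces (3 ℕ.* t)) (λ T → trans
        (cong (λ l → Pr (splittings t T) (consistent? T) ℚ.* ι l) (#splittings-≡ T₀ T))
        (Pr-scale (splittings t T) (consistent? T))))

  good-colouring : 3 ℕ.* t ≤ n → 0ℚ ℚ.< Pr-triangle π →
    Σ[ v ∈ Face t ] Pr-triangle π ℚ.≤ Pr-edge π (colour v) ℚ.+ (ℤ.+ 1 ℚ./ suc (n ∸ 3 ℕ.* t))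
  good-colouring 3t≤n 0<Pr =
    let T₀ , T₀∈ , 0<Pr-T₀ = positive-term (faces (3 ℕ.* t)) (λ T → Pr (splittings t T) (consistent? T)) 0<Pr
        s₀ , s₀∈ , _       = positive-term (splittings t T₀) _ 0<Pr-T₀
    in good-colouring-from 3t≤n T₀ T₀∈ s₀ s₀∈

-- Growth of `r`, the error term and the conclusion

ι-cancel-≤ : ∀ {m n} → ι m ℚ.≤ ι n → m ≤ n
ι-cancel-≤ {m} {n} ιm≤ιn = ℕₚ.≮⇒≥ λ n<m → ℚₚ.<-irrefl refl (begin-strict
  ι n              ≡⟨ ℚₚ.+-identityʳ (ι n) ⟨
  ι n ℚ.+ 0ℚ       <⟨ ℚₚ.+-monoʳ-< (ι n) 0<1 ⟩
  ι n ℚ.+ 1ℚ       ≡⟨ ι-suc n ⟨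
  ι (suc n)        ≤⟨ ι-mono n<m ⟩
  ι m              ≤⟨ ιm≤ιn ⟩
  ι n              ∎)
  where open ℚₚ.≤-Reasoning

0≤/ : ∀ a k → 0ℚ ℚ.≤ (ℤ.+ a ℚ./ suc k)
0≤/ a k = /-mono 0 a 0 k z≤n

module _ (𝔽 : FiniteField) where
  open FiniteField 𝔽 using (order; order-nonTrivial; log-order)
  open LogarithmBounds order {{order-nonTrivial}}

  -- From `n < q ^ n` follows `n ^ (1 + i) ≤ q ^ (n (1 + i))`, so the rounded logarithm in the
  -- numerator is at most `n (1 + i)`.
  ∣log∣≤n : ∀ n i → ℚ.∣ approx (log-order n) i ∣ ℚ.≤ ι n
  ∣log∣≤n zero      i = ℚₚ.≤-refl
  ∣log∣≤n n@(suc _) i = ∣p∣≤ (/-mono a n i 0 (ℕₚ.≤-trans (ℕₚ.≤-reflexive (ℕₚ.*-identityʳ a)) a≤n[1+i]))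
    (ℚₚ.≤-trans (ℚₚ.neg-antimono-≤ (0≤/ a i)) (0≤/ n 0))
    where
    a = ⌊log⌋ order (n ℕ.^ suc i)
    a≤n[1+i] : a ≤ n ℕ.* suc i
    a≤n[1+i] = ℕₚ.≮⇒≥ λ n[1+i]<a → ℕₚ.<-irrefl refl (begin-strict
      n ℕ.^ suc i               ≤⟨ ℕₚ.^-monoˡ-≤ (suc i) (ℕₚ.<⇒≤ (n<q^n n)) ⟩
      (order ℕ.^ n) ℕ.^ suc i   ≡⟨ ℕₚ.^-*-assoc order n (suc i) ⟩
      order ℕ.^ (n ℕ.* suc i)   <⟨ ℕₚ.^-monoʳ-< order 1<q n[1+i]<a ⟩
      order ℕ.^ a               ≤⟨ ⌊log⌋-lower (n ℕ.^ suc i) (ℕₚ.m^n>0 n (suc i)) ⟩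
      n ℕ.^ suc i               ∎)
      where open ℕₚ.≤-Reasoning

  module _ (r : ℕ → ℕ) (r=o[log] : (λ n → fromℕ (r n)) =o log-order) where

    -- The hypothesis on `r` is applied with the constant 1/6, chosen so that `3 r(n)` is eventually
    -- at most half of `n + 1`.
    eventually-6r≤1+n : ∃[ N ] (∀ n → N ≤ n → 6 ℕ.* r n ≤ suc n)
    eventually-6r≤1+n = N , λ n N≤n → ι-cancel-≤ (bound n N≤n)
      where
      sixth : ℚ
      sixth = ℤ.+ 1 ℚ./ 6
      0<sixth : 0ℚ ℚ.< sixth
      0<sixth = ℚₚ.positive⁻¹ sixth
      eventually = r=o[log] (fromℚ sixth) (sixth , 0<sixth , 0 , λ _ _ → ℚₚ.≤-reflexive (ℚₚ.+-identityˡ sixth))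
      N = proj₁ eventually
      bound : ∀ n → N ≤ n → ι (6 ℕ.* r n) ℚ.≤ ι (suc n)
      -- The slack in `_≤ℝ_` is also taken to be 1/6, which accounts for the `1` in `1 + n`. A
      -- single index of the approximations suffices, since `r n` is constant and `∣log∣≤n` holds at
      -- every index.
      bound n N≤n with proj₂ eventually n N≤n sixth 0<sixth
      ... | i , h = begin
        ι (6 ℕ.* r n)                   ≡⟨ trans (ι-* 6 (r n)) (ℚₚ.*-comm (ι 6) (ι (r n))) ⟩
        ι (r n) ℚ.* ι 6                 ≤⟨ ℚₚ.*-monoʳ-≤-nonNeg (ι 6) (begin
          ι (r n)                                             ≡⟨ ℚₚ.0≤p⇒∣p∣≡p (0≤/ (r n) 0) ⟨
          ℚ.∣ ι (r n) ∣                                       ≤⟨ h i ℕₚ.≤-refl ⟩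
          sixth ℚ.* ℚ.∣ approx (log-order n) i ∣ ℚ.+ sixth    ≤⟨ ℚₚ.+-monoˡ-≤ sixth
                                                                  (ℚₚ.*-monoˡ-≤-nonNeg sixth (∣log∣≤n n i)) ⟩
          sixth ℚ.* ι n ℚ.+ sixth                             ≡⟨ cong (ℚ._+ sixth) (1/n*ι 5 n) ⟩
          (ℤ.+ n ℚ./ 6) ℚ.+ sixth                               ≡⟨ suc-/ n 5 ⟨
          ℤ.+ suc n ℚ./ 6                                       ≡⟨ 1/n*ι 5 (suc n) ⟨
          sixth ℚ.* ι (suc n)                                 ∎) ⟩
        sixth ℚ.* ι (suc n) ℚ.* ι 6     ≡⟨ solve 3 (λ a b c → a :* b :* c := a :* c :* b) refl sixth (ι (suc n)) (ι 6) ⟩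
        sixth ℚ.* ι 6 ℚ.* ι (suc n)     ≡⟨ cong (ℚ._* ι (suc n)) (1/n*ιn 5) ⟩
        1ℚ ℚ.* ι (suc n)                ≡⟨ ℚₚ.*-identityˡ _ ⟩
        ι (suc n)                       ∎
        where
        open ℚₚ.≤-Reasoning
        open ℚ-Solver.+-*-Solver

    -- Doubling the goal brings in `6 r(n) ≤ n + 1`; what remains is `2K + 1 ≤ n`, the second
    -- threshold.
    n∸3r⟶∞ : ∀ K → ∃[ N ] (∀ n → N ≤ n → K ≤ n ∸ 3 ℕ.* r n)
    n∸3r⟶∞ K = N ℕ.⊔ suc (2 ℕ.* K) , λ n N≤n →
      ℕₚ.m+n≤o⇒m≤o∸n K (ℕₚ.*-cancelˡ-≤ 2 (begin
        2 ℕ.* (K ℕ.+ 3 ℕ.* r n)           ≡⟨ solve 2 (λ K r → con 2 :* (K :+ con 3 :* r) := con 6 :* r :+ con 2 :* K)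
                                                 refl K (r n) ⟩
        6 ℕ.* r n ℕ.+ 2 ℕ.* K             ≤⟨ ℕₚ.+-monoˡ-≤ (2 ℕ.* K)
                                                 (proj₂ eventually-6r≤1+n n (ℕₚ.m⊔n≤o⇒m≤o N _ N≤n)) ⟩
        suc n ℕ.+ 2 ℕ.* K                 ≡⟨ ℕₚ.+-suc n (2 ℕ.* K) ⟨
        n ℕ.+ suc (2 ℕ.* K)               ≤⟨ ℕₚ.+-monoʳ-≤ n (ℕₚ.m⊔n≤o⇒n≤o N _ N≤n) ⟩
        n ℕ.+ n                           ≡⟨ cong (n ℕ.+_) (ℕₚ.+-identityʳ n) ⟨
        2 ℕ.* n                           ∎))
      where
      open ℕₚ.≤-Reasoning
      open +-*-Solver
      N = proj₁ eventually-6r≤1+n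

    -- The error at the largest admissible dimension `t = r(n)`. Truncated subtraction makes it 1
    -- for the small `n` with `3 r(n) ≥ n`.
    errorℚ : ℕ → ℚ
    errorℚ n = ℤ.+ 1 ℚ./ suc (n ∸ 3 ℕ.* r n)

    error : ℕ → ℝ
    error n = fromℚ (errorℚ n)

    0≤error : ∀ n → 0ℝ ≤ℝ error n
    0≤error n δ 0<δ = 0 , λ _ _ → begin
      0ℚ                ≡⟨ ℚₚ.+-identityʳ 0ℚ ⟨
      0ℚ ℚ.+ 0ℚ         ≤⟨ ℚₚ.+-mono-≤ (0≤/ 1 (n ∸ 3 ℕ.* r n)) (ℚₚ.<⇒≤ 0<δ) ⟩
      errorℚ n ℚ.+ δ    ∎
      where open ℚₚ.≤-Reasoning

    error⟶0 : error ⟶0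
    error⟶0 δ (d , 0<d , M , d≤δ) =
      -- One half of `d` bounds the error, the other is the positive gap required by `_<ℝ_`.
      let η , 0<η , η+η≡d = half 0<d
          K , small       = archimedean η 0<η
          N , large       = n∸3r⟶∞ K
      in N , λ n N≤n → η , 0<η , M , λ i M≤i → begin
        ℚ.∣ errorℚ n ∣ ℚ.+ η    ≡⟨ cong (ℚ._+ η) (ℚₚ.0≤p⇒∣p∣≡p (0≤/ 1 (n ∸ 3 ℕ.* r n))) ⟩
        errorℚ n ℚ.+ η          ≤⟨ ℚₚ.+-monoˡ-≤ η (small _ (large n N≤n)) ⟩
        η ℚ.+ η                 ≡⟨ trans η+η≡d (sym (ℚₚ.+-identityˡ d)) ⟩
        0ℚ ℚ.+ d                ≤⟨ d≤δ i M≤i ⟩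
        approx δ i              ∎
      where open ℚₚ.≤-Reasoning

    expander : ∀ (n m : ℕ) (ξ : ℝ) → 0ℝ <ℝ ξ → ξ <ℝ 1ℝ →
               Grassmann.UGCoboundaryExpander 𝔽 n m (r n) ξ (ξ +ℝ error n)
    expander n m ξ _ (δ , 0<δ , N , ξ+δ≤1) t t≤r 3t≤n π antisymmetric consistent =
      colour v , λ η 0<η → let M , bound = consistent η 0<η in M , λ i M≤i → begin
        1ℚ ℚ.+ ℚ.- (approx ξ i ℚ.+ errorℚ n)
          ≡⟨ solve 2 (λ x e → con 1ℚ :+ :- (x :+ e) := con 1ℚ :+ :- x :- e) refl (approx ξ i) (errorℚ n) ⟩
        1ℚ ℚ.+ ℚ.- approx ξ i ℚ.- errorℚ n
          ≤⟨ ℚₚ.+-monoˡ-≤ (ℚ.- errorℚ n) (begin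
            1ℚ ℚ.+ ℚ.- approx ξ i    ≤⟨ bound i M≤i ⟩
            Pr-triangle π ℚ.+ η      ≤⟨ ℚₚ.+-monoˡ-≤ η Pr-triangle≤ ⟩
            Pr-edge π (colour v) ℚ.+ (ℤ.+ 1 ℚ./ suc (n ∸ 3 ℕ.* t)) ℚ.+ η
                                     ≤⟨ ℚₚ.+-monoˡ-≤ η (ℚₚ.+-monoʳ-≤ (Pr-edge π (colour v)) 1/≤error) ⟩
            Pr-edge π (colour v) ℚ.+ errorℚ n ℚ.+ η ∎) ⟩
        Pr-edge π (colour v) ℚ.+ errorℚ n ℚ.+ η ℚ.- errorℚ n
          ≡⟨ solve 3 (λ p e η → p :+ e :+ η :- e := p :+ η) refl (Pr-edge π (colour v)) (errorℚ n) η ⟩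
        Pr-edge π (colour v) ℚ.+ η ∎
      where
      open ℚₚ.≤-Reasoning
      open ℚ-Solver.+-*-Solver
      open Grassmann 𝔽 n using (Pr-triangle; Pr-edge)
      open Colouring 𝔽 n π antisymmetric using (colour; good-colouring)
      -- The error for dimension `t` increases with `t`, so `t ≤ r(n)` bounds it by the one that
      -- depends on `n` alone.
      1/≤error : (ℤ.+ 1 ℚ./ suc (n ∸ 3 ℕ.* t)) ℚ.≤ errorℚ n
      1/≤error = /-mono 1 1 (n ∸ 3 ℕ.* t) (n ∸ 3 ℕ.* r n)
        (ℕₚ.*-monoʳ-≤ 1 (s≤s (ℕₚ.∸-monoʳ-≤ n (ℕₚ.*-monoʳ-≤ 3 t≤r))))
      -- Eventually `ξ` stays `δ` below 1. Half of `δ` pays for the slack in the consistency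
      -- hypothesis, and the other half remains as a lower bound for the probability.
      0<Pr-triangle : 0ℚ ℚ.< Pr-triangle π
      0<Pr-triangle =
        let η , 0<η , η+η≡δ = half 0<δ
            M , bound       = consistent η 0<η
            i               = N ℕ.⊔ M
            x               = approx ξ i
        in ℚₚ.<-≤-trans 0<η (begin
          η                                  ≡⟨ solve 1 (λ η → η := η :+ η :- η) refl η ⟩
          η ℚ.+ η ℚ.- η                      ≡⟨ cong (ℚ._- η) η+η≡δ ⟩
          δ ℚ.- η                            ≡⟨ solve 3 (λ x δ η → δ :- η := x :+ δ :- x :- η) refl x δ η ⟩
          x ℚ.+ δ ℚ.- x ℚ.- η                ≤⟨ ℚₚ.+-monoˡ-≤ (ℚ.- η)
                                                  (ℚₚ.+-monoˡ-≤ (ℚ.- x) (ξ+δ≤1 i (ℕₚ.m≤m⊔n N M))) ⟩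
          1ℚ ℚ.- x ℚ.- η                     ≤⟨ ℚₚ.+-monoˡ-≤ (ℚ.- η) (bound i (ℕₚ.m≤n⊔m N M)) ⟩
          Pr-triangle π ℚ.+ η ℚ.- η          ≡⟨ solve 2 (λ p η → p :+ η :- η := p) refl (Pr-triangle π) η ⟩
          Pr-triangle π                      ∎)
      v = proj₁ (good-colouring 3t≤n 0<Pr-triangle)
      Pr-triangle≤ = proj₂ (good-colouring 3t≤n 0<Pr-triangle)

lemma6p4 : (𝔽 : FiniteField) (r : ℕ → ℕ) →
    (λ n → fromℕ (r n)) =o FiniteField.log-order 𝔽 →
    Σ[ ε ∈ (ℕ → ℝ) ]
    ((∀ n → 0ℝ ≤ℝ ε n) ×
    ε ⟶0 ×
    (∀ (n m : ℕ) (ξ : ℝ) → 0ℝ <ℝ ξ → ξ <ℝ 1ℝ →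
    Grassmann.UGCoboundaryExpander 𝔽 n m (r n) ξ (ξ +ℝ ε n)))
lemma6p4 𝔽 r r=o = error 𝔽 r r=o , 0≤error 𝔽 r r=o , error⟶0 𝔽 r r=o , expander 𝔽 r r=o
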